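{- Let $G=(V,E)$ be a connected simple undirected graph with $n$ nodes and maximum degree $\Delta$. Let $A\subsetneq V$ and let $i\in A$. For the Metropolis-Hastings walk $RW(G_1)$ starting from node $i$: (i) the expected time to reach a node from $V\setminus A$ is bounded by $$\mathbb E_i T_{V\setminus A}<(|A|+1)(6|A|+2\Delta);$$ (ii) the expected number of visits to node $i$ before any time $t$, $0<t<6n^2$, is bounded by $$\mathbb E_i N_i(t)<5\sqrt t+2\Delta.$$
   Context: The (unit-potential) Metropolis-Hastings walk $RW(G_1)$ is the random walk on $G$ with self-loops and symmetric weights $$w(v,u)=\min\left\{\frac1{\deg(v)},\frac1{\deg(u)}\right\}\ \text{ for }\{v,u\}\in E,\qquad w(v,v)=1-\sum_{u\in\Gamma(v)}w(v,u)\ \text{ for } v\in V,$$ where $\Gamma(v)$ is the set of neighbors of $v$. The total weight at each node is $1$, so from $v$ the walk moves to $u\in\Gamma(v)\cup\{v\}$ with probability $w(v,u)$. $\mathbb E_i$ denotes expectation for the walk started from node $i$ at time $0$. $T_B$ is the first time $\tau>0$ at which the walk is at a node of the set $B$. $N_i(t)$ is the number of times $\tau$ in the interval $[0,t)$ at which the walk is at node $i$; time is discrete and $t$ is an integer. -}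

module Defs where

open import Level using (0ℓ)
open import Algebra.Definitions.RawMonoid using () renaming (sum to rawSum)
open import Data.Bool.Base using (if_then_else_)
open import Data.Fin.Base using (Fin; toℕ)
open import Data.Fin.Properties using (_≟_)
open import Data.Fin.Subset using (Subset; ∣_∣)
open import Data.Fin.Subset.Properties using (_∈?_)
open import Data.Integer.Base using (+_)
open import Data.List.Base as List using ()
open import Data.List.Extrema.Nat using (max)
open import Data.Maybe.Base as Maybe using (Maybe; just; nothing)
open import Data.Maybe.Properties using (≡-dec)
open import Data.Nat.Base as ℕ using (ℕ; zero; suc)
open import Data.Nat.Properties as ℕ using ()
open import Data.Product.Base using (∃-syntax; _×_)
open import Data.Rational.Base
  using (ℚ; 0ℚ; 1ℚ; _+_; _*_; _-_; _/_; _⊓_; _≤_; _<_; +-0-rawMonoid)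
open import Data.Vec.Base as Vec using (Vec; []; _∷_; count)
open import Relation.Binary.Core using (Rel)
open import Relation.Binary.Definitions using (Decidable; Symmetric; Irreflexive)
open import Relation.Binary.Construct.Closure.ReflexiveTransitive using (Star)
open import Relation.Binary.PropositionalEquality.Core using (_≡_)
open import Relation.Nullary.Decidable.Core using (Dec; does)

fromℕ : ℕ → ℚ
fromℕ n = + n / 1

∑ : ∀ {n} → (Fin n → ℚ) → ℚ
∑ = rawSum +-0-rawMonoid

∑[_] : (m : ℕ) → (ℕ → ℚ) → ℚ
∑[ m ] f = ∑ {m} (λ k → f (toℕ k))

𝟙 : {P : Set} → Dec P → ℚ
𝟙 P? = if does P? then 1ℚ else 0ℚ

record SimpleGraph (n : ℕ) : Set₁ where
  field
    Adj     : Rel (Fin n) 0ℓ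
    adj?    : Decidable Adj
    symm    : Symmetric Adj
    irrefl  : Irreflexive _≡_ Adj

  Connected : Set
  Connected = ∀ u v → Star Adj u v

  Γ : Fin n → Subset n
  Γ v = Vec.tabulate (λ u → does (adj? v u))

  deg : Fin n → ℕ
  deg v = ∣ Γ v ∣

  maxDegree : ℕ
  maxDegree = max 0 (List.map deg (List.allFin n))

-- The value at 0 is irrelevant: only degrees of endpoints of edges are inverted.
recip : ℕ → ℚ
recip zero    = 0ℚ
recip (suc d) = + 1 / suc d

-- The Markov chain on Fin n with transition probabilities p.
module Chain {n : ℕ} (p : Fin n → Fin n → ℚ) where

  -- 𝔼 t i f is the expectation, for the walk X with X₀ = i, of
  -- f (X₀ ∷ X₁ ∷ … ∷ Xₜ₋₁).
  𝔼 : (t : ℕ) → Fin n → (Vec (Fin n) t → ℚ) → ℚ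
  𝔼 zero          i f = f []
  𝔼 (suc zero)    i f = f (i ∷ [])
  𝔼 (suc (suc t)) i f = ∑ λ j → p i j * 𝔼 (suc t) j (λ xs → f (i ∷ xs))

  firstIndex : Subset n → ∀ {m} → Vec (Fin n) m → Maybe ℕ
  firstIndex B []       = nothing
  firstIndex B (x ∷ xs) =
    if does (x ∈? B) then just 0 else Maybe.map suc (firstIndex B xs)

  -- The least τ > 0 with X_τ ∈ B, if it occurs along the given trajectory.
  T : Subset n → ∀ {m} → Vec (Fin n) (suc m) → Maybe ℕ
  T B (_ ∷ xs) = Maybe.map suc (firstIndex B xs)

  ℙ[T≡] : Fin n → Subset n → ℕ → ℚ
  ℙ[T≡] i B k = 𝔼 (suc k) i (λ xs → 𝟙 (≡-dec ℕ._≟_ (T B xs) (just k)))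

  N : Fin n → ∀ {t} → Vec (Fin n) t → ℕ
  N i xs = count (i ≟_) xs

  𝔼N : (t : ℕ) → Fin n → ℚ
  𝔼N t i = 𝔼 t i (λ xs → fromℕ (N i xs))

module MetropolisHastings {n : ℕ} (G : SimpleGraph n) where
  open SimpleGraph G

  edgeWeight : Fin n → Fin n → ℚ
  edgeWeight v u = if does (adj? v u) then recip (deg v) ⊓ recip (deg u) else 0ℚ

  weight : Fin n → Fin n → ℚ
  weight v u = if does (v ≟ u) then 1ℚ - ∑ (edgeWeight v) else edgeWeight v u

  open Chain weight public

-- For a random variable T with values in ℕ ∪ {∞} and μ k = ℙ(T = k).
AlmostSurelyFinite : (ℕ → ℚ) → Set
AlmostSurelyFinite μ = ∀ ε → 0ℚ < ε → ∃[ m ] 1ℚ - ε < ∑[ m ] μ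

-- 𝔼 T < q, where 𝔼 T is infinite unless T is almost surely finite, and is
-- otherwise the real number Σₖ k · ℙ(T = k), the supremum of its partial sums.
-- A supremum is < q iff some c < q bounds all the partial sums.
ExpectationBelow : (ℕ → ℚ) → ℚ → Set
ExpectationBelow μ q =
  AlmostSurelyFinite μ ×
  (∃[ c ] c < q × (∀ m → ∑[ m ] (λ k → fromℕ k * μ k) ≤ c))

-- x < a √t + b over the reals, for a > 0: some nonnegative rational r ≤ √t
-- already satisfies x < a r + b.
infix 4 _<_√_+_

_<_√_+_ : ℚ → ℚ → ℕ → ℚ → Set
x < a √ t + b = ∃[ r ] 0ℚ ≤ r × r * r ≤ fromℕ t × x < a * r + b

{-# OPTIONS --safe #-}

-- The walk is an electrical network with unit total conductance at each vertex,
-- in which an edge uv has resistance max (deg u, deg v). Let i ∈ A. A shortest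
-- path from i to V ∖ A has resistance at most R = 6|A| + 2Δ: its edge leaving A
-- costs at most Δ, every other edge at most the sum of the degrees of its ends,
-- and the degree of a vertex at distance k from V ∖ A is at most the number of
-- vertices at distance k − 1, k or k + 1, so each vertex is counted at most
-- 2 · 3 times.
-- Suppose f ≥ 0 vanishes off A and satisfies f ≤ g + Wf on A. Its Dirichlet
-- energy Σ w(u,v)(f u − f v)² over ordered pairs is at most 2 Σ f g, and weighted
-- AM-GM with a parameter l on the edges of the path gives 2 l f(i) ≤ l² R + Σ f g.
--
-- (i) The expected exit time truncated at m satisfies this with g = 1; taking
-- l = |A| at a maximum of f gives f ≤ |A| R.
--
-- (ii) Let f = (h − s)⁺ for h v = 𝔼ᵥ Nᵢ(t) and s = 5√t / 2, rounded down slightly,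
-- with A = {h > s}. As Σ h = t, Markov's inequality gives |A| s ≤ t, so that
-- 6|A| < s; also A ≠ V, since otherwise n s ≤ t and 6n < s contradict t < 6n².
-- The choice g = δᵢ, l = 1 yields h i ≤ s + 6|A| + 2Δ < 2s + 2Δ.
module Submission where

open import Defs
open import Algebra.Bundles using (CommutativeRing)
import Algebra.Properties.Semiring.Sum as SemiringSum
open import Data.Bool.Base using (if_then_else_; true; false)
open import Data.Fin.Base using (Fin; toℕ) renaming (zero to fzero; suc to fsuc)
open import Data.Fin.Properties using (any?) renaming (_≟_ to _≟ᶠ_)
open import Data.Fin.Subset using (Subset; ∣_∣; _∈_; _∉_; _⊂_; ⊤; ∁; inside; outside)
open import Data.Fin.Subset.Properties using (_∈?_; x∈p⇒x∉∁p; x∈∁p⇒x∉p; x∉∁p⇒x∈p; x∉p⇒x∈∁p; ∣⁅x⁆∣≡1; p⊆q⇒∣p∣≤∣q∣; x∈⁅y⁆⇒x≡y)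
open import Data.Nat.Base as ℕ using (ℕ; zero; suc; _+_; _*_; _^_; _<_)
import Data.Nat.Properties as ℕ
open import Data.Nat.Solver using () renaming (module +-*-Solver to ℕ-Solver)
open import Data.List.Base using (allFin)
open import Data.List.Extrema ℕ.≤-totalOrder using (xs≤max)
open import Data.List.Membership.Propositional.Properties using (∈-allFin; ∈-map⁺)
import Data.List.Relation.Unary.All as All
open import Data.Integer.Base as ℤ using (+_; -[1+_])
import Data.Integer.Properties as ℤ
open import Data.Maybe.Base as Maybe using (just; nothing)
open import Data.Maybe.Properties using (≡-dec)
open import Data.Product.Base using (_×_; _,_; ∃-syntax; proj₂)
open import Data.Rational.Base as ℚ using (ℚ; 0ℚ; 1ℚ; _≤_)
import Data.Rational.Properties as ℚ
open import Relation.Binary.Bundles using (DecTotalOrder)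
open import Data.List.Extrema (DecTotalOrder.totalOrder ℚ.≤-decTotalOrder) using (argmax; f[xs]≤f[argmax])
open import Data.Rational.Solver using (module +-*-Solver)
open import Data.Rational.Unnormalised.Base as ℚᵘ using (mkℚᵘ; *≡*)
import Data.Rational.Unnormalised.Properties as ℚᵘ
open import Data.Sum.Base using (_⊎_; inj₁; inj₂)
open import Data.Vec.Base as Vec using ([]; _∷_)
open import Data.Vec.Properties using (lookup∘tabulate; []=⇒lookup; lookup⇒[]=)
open import Function.Base using (_∘_)
open import Relation.Binary.PropositionalEquality
open import Relation.Binary.Construct.Closure.ReflexiveTransitive using (Star; ε; _◅_)
open import Relation.Nullary.Decidable using (dec-true)
open import Relation.Nullary using (Dec; yes; no; does; ¬_; contradiction; ¬?; _⊎-dec_; _×-dec_)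
open SimpleGraph
open MetropolisHastings

open ℕ-Solver using () renaming (solve to ℕ-solve; con to con′; _:+_ to _:+′_; _:*_ to _:*′_; _:=_ to _:=′_)
open +-*-Solver using (solve; con; _:+_; _:*_; _:-_; _:=_)

open SemiringSum (CommutativeRing.semiring ℚ.+-*-commutativeRing)
  using (*-distribˡ-sum; *-distribʳ-sum; ∑-distrib-+; ∑-comm; sum-cong-≗; sum-replicate-zero)

private
  variable
    n : ℕ
    p q r s : ℚ

-- Ordered-field arithmetic in ℚ and the embedding of ℕ.

2ℚ : ℚ
2ℚ = fromℕ 2

slack : p ≤ q → 0ℚ ≤ q ℚ.- p
slack {p} {q} p≤q = subst (_≤ q ℚ.- p) (ℚ.+-inverseʳ p) (ℚ.+-monoˡ-≤ (ℚ.- p) p≤q)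

-- Polynomial estimates below are proved by exhibiting their slack as a nonnegative combination of
-- known slacks; what remains is a ring identity for the solver.
≤-from-slack : ∀ e → 0ℚ ≤ e → p ℚ.+ e ≡ q → p ≤ q
≤-from-slack {p} e 0≤e refl =
  subst (_≤ p ℚ.+ e) (ℚ.+-identityʳ p) (ℚ.+-monoʳ-≤ p 0≤e)

+-nonneg : 0ℚ ≤ p → 0ℚ ≤ q → 0ℚ ≤ p ℚ.+ q
+-nonneg = ℚ.+-mono-≤

*-nonneg : 0ℚ ≤ p → 0ℚ ≤ q → 0ℚ ≤ p ℚ.* q
*-nonneg {p} {q} 0≤p 0≤q =
  subst (_≤ p ℚ.* q) (ℚ.*-zeroʳ p) (ℚ.*-monoˡ-≤-nonNeg p {{ℚ.nonNegative 0≤p}} 0≤q)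

*-monoˡ : 0ℚ ≤ r → p ≤ q → r ℚ.* p ≤ r ℚ.* q
*-monoˡ {r} 0≤r = ℚ.*-monoˡ-≤-nonNeg r {{ℚ.nonNegative 0≤r}}

*-monoʳ : 0ℚ ≤ r → p ≤ q → p ℚ.* r ≤ q ℚ.* r
*-monoʳ {r} 0≤r = ℚ.*-monoʳ-≤-nonNeg r {{ℚ.nonNegative 0≤r}}

square-nonneg : ∀ p → 0ℚ ≤ p ℚ.* p
square-nonneg p with ℚ.≤-total 0ℚ p
... | inj₁ 0≤p = *-nonneg 0≤p 0≤p
... | inj₂ p≤0 = subst (0ℚ ≤_) (solve 1 (λ x → (con 0ℚ :- x) :* (con 0ℚ :- x) := x :* x) refl p)
                   (*-nonneg (slack p≤0) (slack p≤0))

0≤1 : 0ℚ ≤ 1ℚ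
0≤1 = ℚ.nonNegative⁻¹ 1ℚ

0≤2 : 0ℚ ≤ 2ℚ
0≤2 = ℚ.nonNegative⁻¹ 2ℚ

fromℕ-+ : ∀ m n → fromℕ (m + n) ≡ fromℕ m ℚ.+ fromℕ n
fromℕ-+ m n = ℚ.toℚᵘ-injective (begin
  ℚ.toℚᵘ (fromℕ (m + n))                     ≈⟨ ℚ.toℚᵘ-fromℚᵘ (mkℚᵘ (+ (m + n)) 0) ⟩
  mkℚᵘ (+ (m + n)) 0                         ≈⟨ *≡* (cong (ℤ._* + 1) (sym (cong₂ ℤ._+_ (ℤ.*-identityʳ (+ m)) (ℤ.*-identityʳ (+ n))))) ⟩
  mkℚᵘ (+ m) 0 ℚᵘ.+ mkℚᵘ (+ n) 0             ≈⟨ ℚᵘ.≃-sym (ℚᵘ.+-cong (ℚ.toℚᵘ-fromℚᵘ (mkℚᵘ (+ m) 0)) (ℚ.toℚᵘ-fromℚᵘ (mkℚᵘ (+ n) 0))) ⟩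
  ℚ.toℚᵘ (fromℕ m) ℚᵘ.+ ℚ.toℚᵘ (fromℕ n)     ≈⟨ ℚᵘ.≃-sym (ℚ.toℚᵘ-homo-+ (fromℕ m) (fromℕ n)) ⟩
  ℚ.toℚᵘ (fromℕ m ℚ.+ fromℕ n)               ∎)
  where open ℚᵘ.≃-Reasoning

fromℕ-* : ∀ m n → fromℕ (m * n) ≡ fromℕ m ℚ.* fromℕ n
fromℕ-* zero    n = sym (ℚ.*-zeroˡ (fromℕ n))
fromℕ-* (suc m) n = begin
  fromℕ (n + m * n)                            ≡⟨ fromℕ-+ n (m * n) ⟩
  fromℕ n ℚ.+ fromℕ (m * n)                    ≡⟨ cong (fromℕ n ℚ.+_) (fromℕ-* m n) ⟩
  fromℕ n ℚ.+ fromℕ m ℚ.* fromℕ n              ≡⟨ solve 2 (λ x y → y :+ x :* y := (con 1ℚ :+ x) :* y) refl (fromℕ m) (fromℕ n) ⟩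
  (1ℚ ℚ.+ fromℕ m) ℚ.* fromℕ n                 ≡⟨ cong (ℚ._* fromℕ n) (sym (fromℕ-+ 1 m)) ⟩
  fromℕ (suc m) ℚ.* fromℕ n                    ∎
  where open ≡-Reasoning

fromℕ-nonneg : ∀ n → 0ℚ ≤ fromℕ n
fromℕ-nonneg n = ℚ.nonNegative⁻¹ (fromℕ n) {{ℚ.normalize-nonNeg n 1}}

fromℕ-mono-≤ : ∀ {m n} → m ℕ.≤ n → fromℕ m ≤ fromℕ n
fromℕ-mono-≤ {m} {n} m≤n =
  ≤-from-slack (fromℕ (n ℕ.∸ m)) (fromℕ-nonneg (n ℕ.∸ m))
    (trans (sym (fromℕ-+ m (n ℕ.∸ m))) (cong fromℕ (ℕ.m+[n∸m]≡n m≤n)))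

fromℕ-mono-< : ∀ {m n} → m < n → fromℕ m ℚ.< fromℕ n
fromℕ-mono-< {m} m<n = ℚ.<-≤-trans
  (subst₂ ℚ._<_ (ℚ.+-identityˡ (fromℕ m)) (sym (fromℕ-+ 1 m)) (ℚ.+-monoˡ-< (fromℕ m) (ℚ.positive⁻¹ 1ℚ)))
  (fromℕ-mono-≤ m<n)

fromℕ-*-recip : ∀ d → fromℕ (suc d) ℚ.* recip (suc d) ≡ 1ℚ
fromℕ-*-recip d = ℚ.toℚᵘ-injective (begin
  ℚ.toℚᵘ (fromℕ (suc d) ℚ.* recip (suc d))         ≈⟨ ℚ.toℚᵘ-homo-* (fromℕ (suc d)) (recip (suc d)) ⟩
  ℚ.toℚᵘ (fromℕ (suc d)) ℚᵘ.* ℚ.toℚᵘ (recip (suc d)) ≈⟨ ℚᵘ.*-cong (ℚ.toℚᵘ-fromℚᵘ (mkℚᵘ (+ suc d) 0)) (ℚ.toℚᵘ-fromℚᵘ (mkℚᵘ (+ 1) d)) ⟩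
  mkℚᵘ (+ suc d) 0 ℚᵘ.* mkℚᵘ (+ 1) d               ≈⟨ *≡* (cong +_ (solveℕ d)) ⟩
  ℚ.toℚᵘ 1ℚ                                        ∎)
  where
  open ℚᵘ.≃-Reasoning
  solveℕ : ∀ d → suc d * 1 * 1 ≡ 1 * (1 * suc d)
  solveℕ d = trans (trans (ℕ.*-identityʳ (suc d * 1)) (ℕ.*-identityʳ (suc d))) (sym (trans (ℕ.*-identityˡ (1 * suc d)) (ℕ.*-identityˡ (suc d))))

recip-nonneg : ∀ d → 0ℚ ≤ recip d
recip-nonneg zero    = ℚ.≤-refl
recip-nonneg (suc d) = ℚ.nonNegative⁻¹ (recip (suc d)) {{ℚ.normalize-nonNeg 1 (suc d)}}

-- For `e = (a + 1) / (d + 1)` the product `(d + 1) e` is an integer and at least 1, so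
-- `m = (K + 1)(d + 1)` suffices.
archimedean : ∀ K e → 0ℚ ℚ.< e → ∃[ m ] fromℕ K ℚ.< fromℕ m ℚ.* e
archimedean K e@(ℚ.mkℚ (+ suc a) d _) _ = suc K * suc d , (begin-strict
  fromℕ K                                              <⟨ fromℕ-mono-< (ℕ.n<1+n K) ⟩
  fromℕ (suc K)                                        ≡⟨ sym (ℚ.*-identityʳ _) ⟩
  fromℕ (suc K) ℚ.* 1ℚ                                 ≤⟨ *-monoˡ (fromℕ-nonneg (suc K)) (fromℕ-mono-≤ {1} {suc a} (ℕ.s≤s ℕ.z≤n)) ⟩
  fromℕ (suc K) ℚ.* fromℕ (suc a)                      ≡⟨ cong (fromℕ (suc K) ℚ.*_) (sym clear) ⟩
  fromℕ (suc K) ℚ.* (fromℕ (suc d) ℚ.* e)              ≡⟨ sym (ℚ.*-assoc (fromℕ (suc K)) (fromℕ (suc d)) e) ⟩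
  fromℕ (suc K) ℚ.* fromℕ (suc d) ℚ.* e                ≡⟨ cong (ℚ._* e) (sym (fromℕ-* (suc K) (suc d))) ⟩
  fromℕ (suc K * suc d) ℚ.* e                          ∎)
  where
  open ℚ.≤-Reasoning
  clear : fromℕ (suc d) ℚ.* e ≡ fromℕ (suc a)
  clear = ℚ.toℚᵘ-injective (ℚᵘ.≃-trans (ℚ.toℚᵘ-homo-* (fromℕ (suc d)) e)
    (ℚᵘ.≃-trans (ℚᵘ.*-congʳ {mkℚᵘ (+ suc a) d} (ℚ.toℚᵘ-fromℚᵘ (mkℚᵘ (+ suc d) 0)))
    (ℚᵘ.≃-trans (*≡* (cong +_ eq)) (ℚᵘ.≃-sym (ℚ.toℚᵘ-fromℚᵘ (mkℚᵘ (+ suc a) 0))))))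
    where
    eq : suc d * suc a * 1 ≡ suc a * (1 * suc d)
    eq = trans (ℕ.*-identityʳ (suc d * suc a)) (trans (ℕ.*-comm (suc d) (suc a)) (cong (suc a *_) (sym (ℕ.*-identityˡ (suc d)))))
archimedean K (ℚ.mkℚ (+ zero) d c) 0<e = contradiction (ℚ.drop-*<* 0<e) (λ { (ℤ.+<+ ()) })
archimedean K (ℚ.mkℚ -[1+ a ] d c) 0<e = contradiction (ℚ.drop-*<* 0<e) (λ ())

-- Finite sums, indicators and cardinalities.

∑-mono : ∀ {f g : Fin n → ℚ} → (∀ v → f v ≤ g v) → ∑ f ≤ ∑ g
∑-mono {zero}  f≤g = ℚ.≤-refl
∑-mono {suc n} f≤g = ℚ.+-mono-≤ (f≤g fzero) (∑-mono (f≤g ∘ fsuc))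

∑-zero : ∀ n → ∑ {n} (λ _ → 0ℚ) ≡ 0ℚ
∑-zero = sum-replicate-zero

∑-nonneg : ∀ {f : Fin n → ℚ} → (∀ v → 0ℚ ≤ f v) → 0ℚ ≤ ∑ f
∑-nonneg {n} {f} 0≤f = subst (_≤ ∑ f) (∑-zero n) (∑-mono 0≤f)

∑-const : ∀ n c → ∑ {n} (λ _ → c) ≡ fromℕ n ℚ.* c
∑-const zero    c = sym (ℚ.*-zeroˡ c)
∑-const (suc n) c = begin
  c ℚ.+ ∑ {n} (λ _ → c)        ≡⟨ cong (c ℚ.+_) (∑-const n c) ⟩
  c ℚ.+ fromℕ n ℚ.* c          ≡⟨ solve 2 (λ x y → y :+ x :* y := (con 1ℚ :+ x) :* y) refl (fromℕ n) c ⟩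
  (1ℚ ℚ.+ fromℕ n) ℚ.* c       ≡⟨ cong (ℚ._* c) (sym (fromℕ-+ 1 n)) ⟩
  fromℕ (suc n) ℚ.* c          ∎
  where open ≡-Reasoning

∑-- : ∀ (f g : Fin n → ℚ) → ∑ (λ v → f v ℚ.- g v) ≡ ∑ f ℚ.- ∑ g
∑-- f g = begin
  ∑ (λ v → f v ℚ.- g v)                             ≡⟨ solve 2 (λ x y → x := x :+ y :- y) refl _ (∑ g) ⟩
  ∑ (λ v → f v ℚ.- g v) ℚ.+ ∑ g ℚ.- ∑ g             ≡⟨ cong (ℚ._- ∑ g) (sym (∑-distrib-+ _ g)) ⟩
  ∑ (λ v → f v ℚ.- g v ℚ.+ g v) ℚ.- ∑ g             ≡⟨ cong (ℚ._- ∑ g) (sum-cong-≗ (λ v → solve 2 (λ x y → x :- y :+ y := x) refl (f v) (g v))) ⟩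
  ∑ f ℚ.- ∑ g                                       ∎
  where open ≡-Reasoning

𝟙-yes : ∀ {P : Set} (P? : Dec P) → P → 𝟙 P? ≡ 1ℚ
𝟙-yes (yes _) _ = refl
𝟙-yes (no ¬p) p = contradiction p ¬p

𝟙-no : ∀ {P : Set} (P? : Dec P) → ¬ P → 𝟙 P? ≡ 0ℚ
𝟙-no (yes p) ¬p = contradiction p ¬p
𝟙-no (no _)  _  = refl

𝟙-nonneg : ∀ {P : Set} (P? : Dec P) → 0ℚ ≤ 𝟙 P?
𝟙-nonneg (yes _) = 0≤1
𝟙-nonneg (no _)  = ℚ.≤-refl

𝟙-mono : ∀ {P Q : Set} (P? : Dec P) (Q? : Dec Q) → (P → Q) → 𝟙 P? ≤ 𝟙 Q?
𝟙-mono (yes p) Q? f = ℚ.≤-reflexive (sym (𝟙-yes Q? (f p)))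
𝟙-mono (no _)  Q? f = 𝟙-nonneg Q?

𝟙≤1 : ∀ {P : Set} (P? : Dec P) → 𝟙 P? ≤ 1ℚ
𝟙≤1 (yes _) = ℚ.≤-refl
𝟙≤1 (no _)  = 0≤1

𝟙-disjoint : ∀ {P Q R : Set} (P? : Dec P) (Q? : Dec Q) (R? : Dec R) → (P → ¬ Q) → (P → R) → (Q → R) → 𝟙 P? ℚ.+ 𝟙 Q? ≤ 𝟙 R?
𝟙-disjoint (yes p) (yes q) R? disj _ _ = contradiction q (disj p)
𝟙-disjoint (yes p) (no _)  R? _ f _ = ℚ.≤-reflexive (sym (𝟙-yes R? (f p)))
𝟙-disjoint (no _)  (yes q) R? _ _ g = ℚ.≤-reflexive (sym (𝟙-yes R? (g q)))
𝟙-disjoint (no _)  (no _)  R? _ _ _ = 𝟙-nonneg R?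

∑-δ : ∀ (i : Fin n) (f : Fin n → ℚ) → ∑ (λ v → 𝟙 (i ≟ᶠ v) ℚ.* f v) ≡ f i
∑-δ {suc n} fzero f = begin
  1ℚ ℚ.* f fzero ℚ.+ ∑ (λ v → 0ℚ ℚ.* f (fsuc v))  ≡⟨ cong₂ ℚ._+_ (ℚ.*-identityˡ (f fzero)) (sum-cong-≗ (λ v → ℚ.*-zeroˡ (f (fsuc v)))) ⟩
  f fzero ℚ.+ ∑ {n} (λ _ → 0ℚ)                    ≡⟨ cong (f fzero ℚ.+_) (∑-zero n) ⟩
  f fzero ℚ.+ 0ℚ                                  ≡⟨ ℚ.+-identityʳ _ ⟩
  f fzero                                         ∎
  where open ≡-Reasoning
∑-δ {suc n} (fsuc i) f = begin
  0ℚ ℚ.* f fzero ℚ.+ ∑ (λ v → 𝟙 (fsuc i ≟ᶠ fsuc v) ℚ.* f (fsuc v)) ≡⟨ cong₂ ℚ._+_ (ℚ.*-zeroˡ (f fzero)) (∑-δ i (f ∘ fsuc)) ⟩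
  0ℚ ℚ.+ f (fsuc i)                                                ≡⟨ ℚ.+-identityˡ _ ⟩
  f (fsuc i)                                                       ∎
  where open ≡-Reasoning

∣∣-∑ : ∀ (S : Subset n) → fromℕ ∣ S ∣ ≡ ∑ (λ v → if Vec.lookup S v then 1ℚ else 0ℚ)
∣∣-∑ []            = refl
∣∣-∑ (inside  ∷ S) = trans (fromℕ-+ 1 ∣ S ∣) (cong (1ℚ ℚ.+_) (∣∣-∑ S))
∣∣-∑ (outside ∷ S) = trans (∣∣-∑ S) (sym (ℚ.+-identityˡ _))

term≤∑ : ∀ {f : Fin n → ℚ} → (∀ v → 0ℚ ≤ f v) → ∀ i → f i ≤ ∑ f
term≤∑ {f = f} 0≤f i = subst (_≤ ∑ f) (∑-δ i f) (∑-mono pointwise)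
  where
  pointwise : ∀ v → 𝟙 (i ≟ᶠ v) ℚ.* f v ≤ f v
  pointwise v = subst (𝟙 (i ≟ᶠ v) ℚ.* f v ≤_) (ℚ.*-identityˡ (f v)) (*-monoʳ (0≤f v) (𝟙≤1 (i ≟ᶠ v)))

∑∑-δ : ∀ (x y : Fin n) a → ∑ (λ u → ∑ (λ v → 𝟙 (x ≟ᶠ u) ℚ.* (𝟙 (y ≟ᶠ v) ℚ.* a))) ≡ a
∑∑-δ x y a = begin
  ∑ (λ u → ∑ (λ v → 𝟙 (x ≟ᶠ u) ℚ.* (𝟙 (y ≟ᶠ v) ℚ.* a)))  ≡⟨ sum-cong-≗ (λ u → sym (*-distribˡ-sum (𝟙 (x ≟ᶠ u)) (λ v → 𝟙 (y ≟ᶠ v) ℚ.* a))) ⟩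
  ∑ (λ u → 𝟙 (x ≟ᶠ u) ℚ.* ∑ (λ v → 𝟙 (y ≟ᶠ v) ℚ.* a))    ≡⟨ ∑-δ x (λ _ → ∑ (λ v → 𝟙 (y ≟ᶠ v) ℚ.* a)) ⟩
  ∑ (λ v → 𝟙 (y ≟ᶠ v) ℚ.* a)                             ≡⟨ ∑-δ y (λ _ → a) ⟩
  a                                                      ∎
  where open ≡-Reasoning

-- Inequalities for a single edge of the network.

-- The two sides differ by `w (y - l d)²`. Here `y` is the potential drop across an edge of
-- conductance `w` and resistance `d`; equality is Ohm's law for a current `l`.
scaled-AM-GM : ∀ l y {w d} → 0ℚ ≤ w → w ℚ.* d ≡ 1ℚ →
  2ℚ ℚ.* (l ℚ.* y) ≤ l ℚ.* l ℚ.* d ℚ.+ w ℚ.* (y ℚ.* y)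
scaled-AM-GM l y {w} {d} 0≤w wd≡1 = ≤-from-slack (w ℚ.* (z ℚ.* z)) (*-nonneg 0≤w (square-nonneg z)) (begin
  2ℚ ℚ.* (l ℚ.* y) ℚ.+ w ℚ.* (z ℚ.* z)
    ≡⟨ solve 4 (λ l y w d →
         con 2ℚ :* (l :* y) :+ w :* ((y :- l :* d) :* (y :- l :* d))
         := l :* l :* d :* (w :* d) :+ w :* (y :* y) :+ con 2ℚ :* (l :* y) :* (con 1ℚ :- w :* d)) refl l y w d ⟩
  l ℚ.* l ℚ.* d ℚ.* (w ℚ.* d) ℚ.+ w ℚ.* (y ℚ.* y) ℚ.+ 2ℚ ℚ.* (l ℚ.* y) ℚ.* (1ℚ ℚ.- w ℚ.* d)
    ≡⟨ cong (λ e → l ℚ.* l ℚ.* d ℚ.* e ℚ.+ w ℚ.* (y ℚ.* y) ℚ.+ 2ℚ ℚ.* (l ℚ.* y) ℚ.* (1ℚ ℚ.- e)) wd≡1 ⟩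
  l ℚ.* l ℚ.* d ℚ.* 1ℚ ℚ.+ w ℚ.* (y ℚ.* y) ℚ.+ 2ℚ ℚ.* (l ℚ.* y) ℚ.* (1ℚ ℚ.- 1ℚ)
    ≡⟨ solve 4 (λ l y w d →
         l :* l :* d :* con 1ℚ :+ w :* (y :* y) :+ con 2ℚ :* (l :* y) :* (con 1ℚ :- con 1ℚ)
         := l :* l :* d :+ w :* (y :* y)) refl l y w d ⟩
  l ℚ.* l ℚ.* d ℚ.+ w ℚ.* (y ℚ.* y) ∎)
  where
  open ≡-Reasoning
  z = y ℚ.- l ℚ.* d

-- The resistance `d` is the larger of `a` and `b`, selected by deciding which of their inverses is
-- the smaller.
⊓-inverse : ∀ {w p q a b D} → w ≡ p ℚ.⊓ q → p ℚ.* a ≡ 1ℚ → q ℚ.* b ≡ 1ℚ →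
  0ℚ ≤ a → 0ℚ ≤ b → a ≤ D → b ≤ D → ∃[ d ] w ℚ.* d ≡ 1ℚ × d ≤ a ℚ.+ b × d ≤ D
⊓-inverse {p = p} {q} {a} {b} refl pa≡1 qb≡1 0≤a 0≤b a≤D b≤D with ℚ.≤-total p q
... | inj₁ p≤q = a , trans (cong (ℚ._* a) (ℚ.p≤q⇒p⊓q≡p p≤q)) pa≡1 , ≤-from-slack b 0≤b refl , a≤D
... | inj₂ q≤p = b , trans (cong (ℚ._* b) (ℚ.p≥q⇒p⊓q≡q q≤p)) qb≡1 , ≤-from-slack a 0≤a (ℚ.+-comm b a) , b≤D

private
  -- X = λ f(v), Y = λ f(u); dv, du, D and β are λ² times degrees, Δ and an annulus size.
  base-step : ∀ {X d dv e D E₀ E₁} → 2ℚ ℚ.* X ≤ d ℚ.+ e → d ≤ D → dv ≤ D → E₀ ℚ.+ 2ℚ ℚ.* e ≤ E₁ → 0ℚ ≤ E₀ →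
    2ℚ ℚ.* (2ℚ ℚ.* X ℚ.+ dv) ≤ 2ℚ ℚ.* (2ℚ ℚ.* D) ℚ.+ E₁
  base-step {X} {d} {dv} {e} {D} {E₀} {E₁} amgm d≤ dv≤ grow 0≤E₀ = ≤-from-slack
    (2ℚ ℚ.* (d ℚ.+ e ℚ.- 2ℚ ℚ.* X) ℚ.+ 2ℚ ℚ.* (D ℚ.- d) ℚ.+ 2ℚ ℚ.* (D ℚ.- dv) ℚ.+ (E₁ ℚ.- (E₀ ℚ.+ 2ℚ ℚ.* e)) ℚ.+ E₀)
    (+-nonneg (+-nonneg (+-nonneg (+-nonneg
      (*-nonneg 0≤2 (slack amgm)) (*-nonneg 0≤2 (slack d≤))) (*-nonneg 0≤2 (slack dv≤))) (slack grow)) 0≤E₀)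
    (solve 7 (λ X d dv e D E₀ E₁ →
      con 2ℚ :* (con 2ℚ :* X :+ dv) :+ (con 2ℚ :* (d :+ e :- con 2ℚ :* X) :+ con 2ℚ :* (D :- d) :+ con 2ℚ :* (D :- dv)
        :+ (E₁ :- (E₀ :+ con 2ℚ :* e)) :+ E₀)
      := con 2ℚ :* (con 2ℚ :* D) :+ E₁) refl X d dv e D E₀ E₁)

  inductive-step : ∀ {X Y d dv du e R β E₁ E₂} → 2ℚ ℚ.* (2ℚ ℚ.* Y ℚ.+ du) ≤ 2ℚ ℚ.* R ℚ.+ E₁ →
    2ℚ ℚ.* (X ℚ.- Y) ≤ d ℚ.+ e → d ≤ dv ℚ.+ du → dv ≤ β → E₁ ℚ.+ 2ℚ ℚ.* e ≤ E₂ →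
    2ℚ ℚ.* (2ℚ ℚ.* X ℚ.+ dv) ≤ 2ℚ ℚ.* (R ℚ.+ 2ℚ ℚ.* β) ℚ.+ E₂
  inductive-step {X} {Y} {d} {dv} {du} {e} {R} {β} {E₁} {E₂} previous amgm d≤ dv≤ grow = ≤-from-slack
    ((2ℚ ℚ.* R ℚ.+ E₁ ℚ.- 2ℚ ℚ.* (2ℚ ℚ.* Y ℚ.+ du)) ℚ.+ 2ℚ ℚ.* (d ℚ.+ e ℚ.- 2ℚ ℚ.* (X ℚ.- Y))
      ℚ.+ 2ℚ ℚ.* (dv ℚ.+ du ℚ.- d) ℚ.+ 2ℚ ℚ.* (2ℚ ℚ.* (β ℚ.- dv)) ℚ.+ (E₂ ℚ.- (E₁ ℚ.+ 2ℚ ℚ.* e)))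
    (+-nonneg (+-nonneg (+-nonneg (+-nonneg
      (slack previous) (*-nonneg 0≤2 (slack amgm))) (*-nonneg 0≤2 (slack d≤)))
      (*-nonneg 0≤2 (*-nonneg 0≤2 (slack dv≤)))) (slack grow))
    (solve 10 (λ X Y d dv du e R β E₁ E₂ →
      con 2ℚ :* (con 2ℚ :* X :+ dv) :+ ((con 2ℚ :* R :+ E₁ :- con 2ℚ :* (con 2ℚ :* Y :+ du)) :+ con 2ℚ :* (d :+ e :- con 2ℚ :* (X :- Y))
        :+ con 2ℚ :* (dv :+ du :- d) :+ con 2ℚ :* (con 2ℚ :* (β :- dv)) :+ (E₂ :- (E₁ :+ con 2ℚ :* e)))
      := con 2ℚ :* (R :+ con 2ℚ :* β) :+ E₂) refl X Y d dv du e R β E₁ E₂)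

-- Subsets of `Fin n` and shifted first indices.

x∈p⇒1≤∣p∣ : ∀ {x} {S : Subset n} → x ∈ S → 1 ℕ.≤ ∣ S ∣
x∈p⇒1≤∣p∣ {x = x} {S} x∈S = subst (ℕ._≤ ∣ S ∣) (∣⁅x⁆∣≡1 x) (p⊆q⇒∣p∣≤∣q∣ (λ y∈ → subst (_∈ S) (sym (x∈⁅y⁆⇒x≡y x y∈)) x∈S))

select : {P : Fin n → Set} → (∀ v → Dec (P v)) → Subset n
select P? = Vec.tabulate (λ v → does (P? v))

∈-select⁻ : ∀ {P : Fin n → Set} (P? : ∀ v → Dec (P v)) {v} → v ∈ select P? → P v
∈-select⁻ P? {v} v∈ with P? v | trans (sym (lookup∘tabulate (λ u → does (P? u)) v)) ([]=⇒lookup v∈)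
... | yes p | _ = p

∈-select⁺ : ∀ {P : Fin n → Set} (P? : ∀ v → Dec (P v)) {v} → P v → v ∈ select P?
∈-select⁺ P? {v} p = lookup⇒[]= v (select P?) (trans (lookup∘tabulate (λ u → does (P? u)) v) (dec-true (P? v) p))

𝟙-map-suc : ∀ x k → 𝟙 (≡-dec ℕ._≟_ (Maybe.map suc x) (just (suc k))) ≡ 𝟙 (≡-dec ℕ._≟_ x (just k))
𝟙-map-suc nothing  k = refl
𝟙-map-suc (just x) k = refl

-- Symmetric Markov chains and their Dirichlet energy.

record IsSymmetricChain (W : Fin n → Fin n → ℚ) : Set where
  field
    nonneg   : ∀ u v → 0ℚ ≤ W u v
    symmetric : ∀ u v → W u v ≡ W v u
    row-sum  : ∀ u → ∑ (W u) ≡ 1ℚ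

module SymmetricChain {n} {W : Fin n → Fin n → ℚ} (isSymmetricChain : IsSymmetricChain W) where
  open IsSymmetricChain isSymmetricChain

  avg : (Fin n → ℚ) → Fin n → ℚ
  avg f v = ∑ λ u → W v u ℚ.* f u

  avg-const : ∀ c v → avg (λ _ → c) v ≡ c
  avg-const c v = trans (sym (*-distribʳ-sum c (W v))) (trans (cong (ℚ._* c) (row-sum v)) (ℚ.*-identityˡ c))

  avg-mono : ∀ {f g} → (∀ v → f v ≤ g v) → ∀ v → avg f v ≤ avg g v
  avg-mono f≤g v = ∑-mono (λ u → *-monoˡ (nonneg v u) (f≤g u))

  avg-cong : ∀ {f g} → (∀ v → f v ≡ g v) → ∀ v → avg f v ≡ avg g v
  avg-cong f≡g v = sum-cong-≗ (λ u → cong (W v u ℚ.*_) (f≡g u))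

  avg-nonneg : ∀ {f} → (∀ v → 0ℚ ≤ f v) → ∀ v → 0ℚ ≤ avg f v
  avg-nonneg 0≤f v = ∑-nonneg (λ u → *-nonneg (nonneg v u) (0≤f u))

  avg-+ : ∀ f g v → avg (λ u → f u ℚ.+ g u) v ≡ avg f v ℚ.+ avg g v
  avg-+ f g v = trans (sum-cong-≗ (λ u → ℚ.*-distribˡ-+ (W v u) (f u) (g u)))
                      (∑-distrib-+ (λ u → W v u ℚ.* f u) (λ u → W v u ℚ.* g u))

  avg-- : ∀ f g v → avg (λ u → f u ℚ.- g u) v ≡ avg f v ℚ.- avg g v
  avg-- f g v = trans
    (sum-cong-≗ (λ u → solve 3 (λ w x y → w :* (x :- y) := w :* x :- w :* y) refl (W v u) (f u) (g u)))
    (∑-- (λ u → W v u ℚ.* f u) (λ u → W v u ℚ.* g u))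

  avg-* : ∀ c f v → avg (λ u → c ℚ.* f u) v ≡ c ℚ.* avg f v
  avg-* c f v = trans
    (sum-cong-≗ (λ u → solve 3 (λ w c x → w :* (c :* x) := c :* (w :* x)) refl (W v u) c (f u)))
    (sym (*-distribˡ-sum c (λ u → W v u ℚ.* f u)))

  -- By symmetry the columns of `W` also sum to 1: counting measure is stationary.
  ∑-avg : ∀ f → ∑ (avg f) ≡ ∑ f
  ∑-avg f = begin
    ∑ (λ v → ∑ (λ u → W v u ℚ.* f u))  ≡⟨ ∑-comm (λ v u → W v u ℚ.* f u) ⟩
    ∑ (λ u → ∑ (λ v → W v u ℚ.* f u))  ≡⟨ sum-cong-≗ (λ u → sum-cong-≗ (λ v → cong (ℚ._* f u) (symmetric v u))) ⟩
    ∑ (λ u → ∑ (λ v → W u v ℚ.* f u))  ≡⟨ sum-cong-≗ (λ u → avg-const (f u) u) ⟩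
    ∑ f                                ∎
    where open ≡-Reasoning

  edgeEnergy : (Fin n → ℚ) → Fin n → Fin n → ℚ
  edgeEnergy f u v = W u v ℚ.* ((f u ℚ.- f v) ℚ.* (f u ℚ.- f v))

  edgeEnergy-nonneg : ∀ f u v → 0ℚ ≤ edgeEnergy f u v
  edgeEnergy-nonneg f u v = *-nonneg (nonneg u v) (square-nonneg (f u ℚ.- f v))

  edgeEnergy-symmetric : ∀ f u v → edgeEnergy f u v ≡ edgeEnergy f v u
  edgeEnergy-symmetric f u v = trans
    (cong (ℚ._* ((f u ℚ.- f v) ℚ.* (f u ℚ.- f v))) (symmetric u v))
    (solve 3 (λ w x y → w :* ((x :- y) :* (x :- y)) := w :* ((y :- x) :* (y :- x))) refl (W v u) (f u) (f v))

  energy : (Fin n → ℚ) → ℚ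
  energy f = ∑ λ u → ∑ λ v → edgeEnergy f u v

  -- Summation by parts. Expanding the square in row `u` leaves the remainder `avg f² u - f² u`, and
  -- these remainders sum to zero because counting measure is stationary.
  energy-Dirichlet : ∀ f → energy f ≡ 2ℚ ℚ.* ∑ (λ u → f u ℚ.* (f u ℚ.- avg f u))
  energy-Dirichlet f = begin
    ∑ (λ u → ∑ (edgeEnergy f u))
      ≡⟨ sum-cong-≗ row ⟩
    ∑ (λ u → 2ℚ ℚ.* (f u ℚ.* (f u ℚ.- avg f u)) ℚ.+ (avg f² u ℚ.- f² u))
      ≡⟨ ∑-distrib-+ (λ u → 2ℚ ℚ.* (f u ℚ.* (f u ℚ.- avg f u))) (λ u → avg f² u ℚ.- f² u) ⟩
    ∑ (λ u → 2ℚ ℚ.* (f u ℚ.* (f u ℚ.- avg f u))) ℚ.+ ∑ (λ u → avg f² u ℚ.- f² u)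
      ≡⟨ cong₂ ℚ._+_ (sym (*-distribˡ-sum 2ℚ (λ u → f u ℚ.* (f u ℚ.- avg f u)))) (∑-- (avg f²) f²) ⟩
    2ℚ ℚ.* ∑ (λ u → f u ℚ.* (f u ℚ.- avg f u)) ℚ.+ (∑ (avg f²) ℚ.- ∑ f²)
      ≡⟨ cong (λ e → 2ℚ ℚ.* ∑ (λ u → f u ℚ.* (f u ℚ.- avg f u)) ℚ.+ (e ℚ.- ∑ f²)) (∑-avg f²) ⟩
    2ℚ ℚ.* ∑ (λ u → f u ℚ.* (f u ℚ.- avg f u)) ℚ.+ (∑ f² ℚ.- ∑ f²)
      ≡⟨ solve 2 (λ x y → x :+ (y :- y) := x) refl (2ℚ ℚ.* ∑ (λ u → f u ℚ.* (f u ℚ.- avg f u))) (∑ f²) ⟩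
    2ℚ ℚ.* ∑ (λ u → f u ℚ.* (f u ℚ.- avg f u)) ∎
    where
    open ≡-Reasoning
    f² : Fin n → ℚ
    f² v = f v ℚ.* f v
    row : ∀ u → ∑ (edgeEnergy f u) ≡ 2ℚ ℚ.* (f u ℚ.* (f u ℚ.- avg f u)) ℚ.+ (avg f² u ℚ.- f² u)
    row u = begin
      ∑ (edgeEnergy f u)
        ≡⟨ sum-cong-≗ (λ v → solve 3 (λ w x y →
             w :* ((x :- y) :* (x :- y)) := w :* (x :* x :+ ((con 0ℚ :- con 2ℚ :* x) :* y :+ y :* y)))
             refl (W u v) (f u) (f v)) ⟩
      avg (λ v → f² u ℚ.+ ((0ℚ ℚ.- 2ℚ ℚ.* f u) ℚ.* f v ℚ.+ f² v)) u
        ≡⟨ avg-+ (λ _ → f² u) (λ v → (0ℚ ℚ.- 2ℚ ℚ.* f u) ℚ.* f v ℚ.+ f² v) u ⟩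
      avg (λ _ → f² u) u ℚ.+ avg (λ v → (0ℚ ℚ.- 2ℚ ℚ.* f u) ℚ.* f v ℚ.+ f² v) u
        ≡⟨ cong₂ ℚ._+_ (avg-const (f² u) u) (avg-+ (λ v → (0ℚ ℚ.- 2ℚ ℚ.* f u) ℚ.* f v) f² u) ⟩
      f² u ℚ.+ (avg (λ v → (0ℚ ℚ.- 2ℚ ℚ.* f u) ℚ.* f v) u ℚ.+ avg f² u)
        ≡⟨ cong (λ e → f² u ℚ.+ (e ℚ.+ avg f² u)) (avg-* (0ℚ ℚ.- 2ℚ ℚ.* f u) f u) ⟩
      f² u ℚ.+ ((0ℚ ℚ.- 2ℚ ℚ.* f u) ℚ.* avg f u ℚ.+ avg f² u)
        ≡⟨ solve 3 (λ x y z → x :* x :+ ((con 0ℚ :- con 2ℚ :* x) :* y :+ z)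
             := con 2ℚ :* (x :* (x :- y)) :+ (z :- x :* x)) refl (f u) (avg f u) (avg f² u) ⟩
      2ℚ ℚ.* (f u ℚ.* (f u ℚ.- avg f u)) ℚ.+ (avg f² u ℚ.- f² u) ∎

  -- For `χ` the indicator of a set of vertices, this is the energy of the edges with both ends in
  -- the set.
  energyOn : (Fin n → ℚ) → (Fin n → ℚ) → ℚ
  energyOn χ f = ∑ λ u → ∑ λ v → χ u ℚ.* χ v ℚ.* edgeEnergy f u v

  private
    restricted-mono : ∀ f {χ χ′ : Fin n → ℚ} → (∀ v → 0ℚ ≤ χ v) → (∀ v → χ v ≤ χ′ v) →
      ∀ u v → χ u ℚ.* χ v ℚ.* edgeEnergy f u v ≤ χ′ u ℚ.* χ′ v ℚ.* edgeEnergy f u v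
    restricted-mono f {χ} {χ′} 0≤χ χ≤χ′ u v = *-monoʳ (edgeEnergy-nonneg f u v)
      (ℚ.≤-trans (*-monoʳ (0≤χ v) (χ≤χ′ u)) (*-monoˡ (ℚ.≤-trans (0≤χ u) (χ≤χ′ u)) (χ≤χ′ v)))

  energyOn-≤-energy : ∀ f {χ} → (∀ v → 0ℚ ≤ χ v) → (∀ v → χ v ≤ 1ℚ) → energyOn χ f ≤ energy f
  energyOn-≤-energy f {χ} 0≤χ χ≤1 = ∑-mono (λ u → ∑-mono (λ v →
    subst (χ u ℚ.* χ v ℚ.* edgeEnergy f u v ≤_) (ℚ.*-identityˡ (edgeEnergy f u v))
      (restricted-mono f {χ} {λ _ → 1ℚ} 0≤χ χ≤1 u v)))

  energyOn-nonneg : ∀ f {χ} → (∀ v → 0ℚ ≤ χ v) → 0ℚ ≤ energyOn χ f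
  energyOn-nonneg f 0≤χ = ∑-nonneg (λ u → ∑-nonneg (λ v →
    *-nonneg (*-nonneg (0≤χ u) (0≤χ v)) (edgeEnergy-nonneg f u v)))

  -- An edge xy leaving the support of χ contributes to both ordered pairs.
  energyOn-grow : ∀ f {χ χ′} → (∀ v → 0ℚ ≤ χ v) → (∀ v → χ v ≤ χ′ v) →
    ∀ {x y} → x ≢ y → χ x ≡ 0ℚ → χ′ x ≡ 1ℚ → χ′ y ≡ 1ℚ →
    energyOn χ f ℚ.+ 2ℚ ℚ.* edgeEnergy f x y ≤ energyOn χ′ f
  energyOn-grow f {χ} {χ′} 0≤χ χ≤χ′ {x} {y} x≢y χx χ′x χ′y = subst (_≤ energyOn χ′ f) total
    (∑-mono (λ u → ∑-mono (pointwise u)))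
    where
    a = edgeEnergy f x y
    e e′ δ : Fin n → Fin n → ℚ
    e  u v = χ u ℚ.* χ v ℚ.* edgeEnergy f u v
    e′ u v = χ′ u ℚ.* χ′ v ℚ.* edgeEnergy f u v
    δ  u v = 𝟙 (x ≟ᶠ u) ℚ.* (𝟙 (y ≟ᶠ v) ℚ.* a) ℚ.+ 𝟙 (y ≟ᶠ u) ℚ.* (𝟙 (x ≟ᶠ v) ℚ.* a)
    0≤χ′ : ∀ v → 0ℚ ≤ χ′ v
    0≤χ′ v = ℚ.≤-trans (0≤χ v) (χ≤χ′ v)
    0≤e′ : ∀ u v → 0ℚ ≤ e′ u v
    0≤e′ u v = *-nonneg (*-nonneg (0≤χ′ u) (0≤χ′ v)) (edgeEnergy-nonneg f u v)
    ∑∑-+ : ∀ (g h : Fin n → Fin n → ℚ) →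
      ∑ (λ u → ∑ (λ v → g u v ℚ.+ h u v)) ≡ ∑ (λ u → ∑ (g u)) ℚ.+ ∑ (λ u → ∑ (h u))
    ∑∑-+ g h = trans (sum-cong-≗ (λ u → ∑-distrib-+ (g u) (h u))) (∑-distrib-+ (λ u → ∑ (g u)) (λ u → ∑ (h u)))
    total : ∑ (λ u → ∑ (λ v → e u v ℚ.+ δ u v)) ≡ energyOn χ f ℚ.+ 2ℚ ℚ.* a
    total = trans (∑∑-+ e δ) (cong (energyOn χ f ℚ.+_)
      (trans (∑∑-+ (λ u v → 𝟙 (x ≟ᶠ u) ℚ.* (𝟙 (y ≟ᶠ v) ℚ.* a)) (λ u v → 𝟙 (y ≟ᶠ u) ℚ.* (𝟙 (x ≟ᶠ v) ℚ.* a)))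
      (trans (cong₂ ℚ._+_ (∑∑-δ x y a) (∑∑-δ y x a))
             (solve 1 (λ a → a :+ a := con 2ℚ :* a) refl a))))
    pointwise : ∀ u v → e u v ℚ.+ δ u v ≤ e′ u v
    zero-restricted : ∀ {c} k → c ≡ 0ℚ → c ℚ.* k ≡ 0ℚ
    zero-restricted k c≡0 = trans (cong (ℚ._* k) c≡0) (ℚ.*-zeroˡ k)
    from-x : ∀ v → χ x ℚ.* χ v ≡ 0ℚ
    from-x v = trans (cong (ℚ._* χ v) χx) (ℚ.*-zeroˡ (χ v))
    to-x : ∀ u → χ u ℚ.* χ x ≡ 0ℚ
    to-x u = trans (cong (χ u ℚ.*_) χx) (ℚ.*-zeroʳ (χ u))
    full : ∀ {u v} → χ′ u ≡ 1ℚ → χ′ v ≡ 1ℚ → e′ u v ≡ edgeEnergy f u v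
    full {u} {v} χ′u χ′v = trans (cong₂ (λ c d → c ℚ.* d ℚ.* edgeEnergy f u v) χ′u χ′v) (ℚ.*-identityˡ _)
    -- Every pair involving `x` has weight zero under `χ`, so at `(x , y)` and `(y , x)` the new
    -- energy has to cover `a` alone. At all other pairs `δ` vanishes, and nonnegativity or
    -- monotonicity in `χ` suffices.
    pointwise u v with x ≟ᶠ u | y ≟ᶠ v | y ≟ᶠ u | x ≟ᶠ v
    ... | yes refl | _ | yes refl | _ = contradiction refl x≢y
    ... | yes refl | yes refl | no _ | d = ℚ.≤-reflexive (begin
          e x y ℚ.+ (1ℚ ℚ.* (1ℚ ℚ.* a) ℚ.+ 0ℚ ℚ.* (𝟙 d ℚ.* a))
            ≡⟨ cong (ℚ._+ (1ℚ ℚ.* (1ℚ ℚ.* a) ℚ.+ 0ℚ ℚ.* (𝟙 d ℚ.* a))) (zero-restricted a (from-x y)) ⟩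
          0ℚ ℚ.+ (1ℚ ℚ.* (1ℚ ℚ.* a) ℚ.+ 0ℚ ℚ.* (𝟙 d ℚ.* a))
            ≡⟨ solve 2 (λ a b → con 0ℚ :+ (con 1ℚ :* (con 1ℚ :* a) :+ con 0ℚ :* b) := a) refl a (𝟙 d ℚ.* a) ⟩
          a      ≡⟨ sym (full χ′x χ′y) ⟩
          e′ x y ∎)
      where open ≡-Reasoning
    ... | yes refl | no _ | no _ | d = ℚ.≤-trans (ℚ.≤-reflexive (begin
          e x v ℚ.+ (1ℚ ℚ.* (0ℚ ℚ.* a) ℚ.+ 0ℚ ℚ.* (𝟙 d ℚ.* a))
            ≡⟨ cong (ℚ._+ (1ℚ ℚ.* (0ℚ ℚ.* a) ℚ.+ 0ℚ ℚ.* (𝟙 d ℚ.* a))) (zero-restricted (edgeEnergy f x v) (from-x v)) ⟩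
          0ℚ ℚ.+ (1ℚ ℚ.* (0ℚ ℚ.* a) ℚ.+ 0ℚ ℚ.* (𝟙 d ℚ.* a))
            ≡⟨ solve 2 (λ a b → con 0ℚ :+ (con 1ℚ :* (con 0ℚ :* a) :+ con 0ℚ :* b) := con 0ℚ) refl a (𝟙 d ℚ.* a) ⟩
          0ℚ     ∎)) (0≤e′ x v)
      where open ≡-Reasoning
    ... | no _ | d | yes refl | yes refl = ℚ.≤-reflexive (begin
          e y x ℚ.+ (0ℚ ℚ.* (𝟙 d ℚ.* a) ℚ.+ 1ℚ ℚ.* (1ℚ ℚ.* a))
            ≡⟨ cong (ℚ._+ (0ℚ ℚ.* (𝟙 d ℚ.* a) ℚ.+ 1ℚ ℚ.* (1ℚ ℚ.* a))) (zero-restricted (edgeEnergy f y x) (to-x y)) ⟩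
          0ℚ ℚ.+ (0ℚ ℚ.* (𝟙 d ℚ.* a) ℚ.+ 1ℚ ℚ.* (1ℚ ℚ.* a))
            ≡⟨ solve 2 (λ a b → con 0ℚ :+ (con 0ℚ :* b :+ con 1ℚ :* (con 1ℚ :* a)) := a) refl a (𝟙 d ℚ.* a) ⟩
          a                   ≡⟨ edgeEnergy-symmetric f x y ⟩
          edgeEnergy f y x    ≡⟨ sym (full χ′y χ′x) ⟩
          e′ y x ∎)
      where open ≡-Reasoning
    ... | no _ | d | yes refl | no _ = subst (_≤ e′ y v)
          (solve 3 (λ e b a → e := e :+ (con 0ℚ :* b :+ con 1ℚ :* (con 0ℚ :* a))) refl (e y v) (𝟙 d ℚ.* a) a)
          (restricted-mono f {χ} {χ′} 0≤χ χ≤χ′ y v)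
    ... | no _ | d | no _ | d′ = subst (_≤ e′ u v)
          (solve 3 (λ e b c → e := e :+ (con 0ℚ :* b :+ con 0ℚ :* c)) refl (e u v) (𝟙 d ℚ.* a) (𝟙 d′ ℚ.* a))
          (restricted-mono f {χ} {χ′} 0≤χ χ≤χ′ u v)

  -- In the Dirichlet form of the energy each term `f (f - avg f)` is at most `f g`: on `A` by the
  -- subsolution inequality and `f ≥ 0`, off `A` because `f` vanishes there.
  energy-subsolution : ∀ {f g : Fin n → ℚ} (A : Subset n) → (∀ v → 0ℚ ≤ f v) → (∀ {v} → v ∉ A → f v ≡ 0ℚ) →
    (∀ {v} → v ∈ A → f v ≤ g v ℚ.+ avg f v) → energy f ≤ 2ℚ ℚ.* ∑ (λ v → f v ℚ.* g v)
  energy-subsolution {f} {g} A 0≤f off sub =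
    subst (_≤ 2ℚ ℚ.* ∑ (λ v → f v ℚ.* g v)) (sym (energy-Dirichlet f)) (*-monoˡ 0≤2 (∑-mono pointwise))
    where
    pointwise : ∀ v → f v ℚ.* (f v ℚ.- avg f v) ≤ f v ℚ.* g v
    pointwise v with v ∈? A
    ... | yes v∈A = *-monoˡ (0≤f v) (≤-from-slack (g v ℚ.+ avg f v ℚ.- f v) (slack (sub v∈A))
                      (solve 3 (λ x y z → x :- y :+ (z :+ y :- x) := z) refl (f v) (avg f v) (g v)))
    ... | no  v∉A = ℚ.≤-reflexive (trans (cong (ℚ._* (f v ℚ.- avg f v)) (off v∉A))
                      (trans (ℚ.*-zeroˡ (f v ℚ.- avg f v)) (trans (sym (ℚ.*-zeroˡ (g v))) (cong (ℚ._* g v) (sym (off v∉A))))))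

-- Expected visits and exit times through first-step recursions.

module Expectations {n} {W : Fin n → Fin n → ℚ} (isSymmetricChain : IsSymmetricChain W) where
  open IsSymmetricChain isSymmetricChain
  open SymmetricChain isSymmetricChain
  private module X = Chain W

  𝔼-cong : ∀ t j {f g : Vec.Vec (Fin n) t → ℚ} → (∀ xs → f xs ≡ g xs) → X.𝔼 t j f ≡ X.𝔼 t j g
  𝔼-cong zero          j f≡g = f≡g []
  𝔼-cong (suc zero)    j f≡g = f≡g (j ∷ [])
  𝔼-cong (suc (suc t)) j f≡g = avg-cong (λ u → 𝔼-cong (suc t) u (λ xs → f≡g (j ∷ xs))) j

  𝔼-const : ∀ t j c → X.𝔼 t j (λ _ → c) ≡ c
  𝔼-const zero          j c = refl
  𝔼-const (suc zero)    j c = refl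
  𝔼-const (suc (suc t)) j c = trans (avg-cong (λ u → 𝔼-const (suc t) u c) j) (avg-const c j)

  𝔼-+ : ∀ t j c (f : Vec.Vec (Fin n) t → ℚ) → X.𝔼 t j (λ xs → c ℚ.+ f xs) ≡ c ℚ.+ X.𝔼 t j f
  𝔼-+ zero          j c f = refl
  𝔼-+ (suc zero)    j c f = refl
  𝔼-+ (suc (suc t)) j c f = begin
    avg (λ u → X.𝔼 (suc t) u (λ xs → c ℚ.+ f (j ∷ xs))) j                      ≡⟨ avg-cong (λ u → 𝔼-+ (suc t) u c (λ xs → f (j ∷ xs))) j ⟩
    avg (λ u → c ℚ.+ X.𝔼 (suc t) u (λ xs → f (j ∷ xs))) j                      ≡⟨ avg-+ (λ _ → c) (λ u → X.𝔼 (suc t) u (λ xs → f (j ∷ xs))) j ⟩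
    avg (λ _ → c) j ℚ.+ avg (λ u → X.𝔼 (suc t) u (λ xs → f (j ∷ xs))) j        ≡⟨ cong (ℚ._+ avg (λ u → X.𝔼 (suc t) u (λ xs → f (j ∷ xs))) j) (avg-const c j) ⟩
    c ℚ.+ avg (λ u → X.𝔼 (suc t) u (λ xs → f (j ∷ xs))) j                      ∎
    where open ≡-Reasoning

  module Visits (i : Fin n) where

    -- 𝔼ⱼ Nᵢ(t)
    visits : ℕ → Fin n → ℚ
    visits zero    v = 0ℚ
    visits (suc t) v = 𝟙 (i ≟ᶠ v) ℚ.+ avg (visits t) v

    fromℕ-N-∷ : ∀ {t} v (xs : Vec.Vec (Fin n) t) → fromℕ (X.N i (v ∷ xs)) ≡ 𝟙 (i ≟ᶠ v) ℚ.+ fromℕ (X.N i xs)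
    fromℕ-N-∷ v xs with i ≟ᶠ v
    ... | yes _ = fromℕ-+ 1 (X.N i xs)
    ... | no _  = sym (ℚ.+-identityˡ (fromℕ (X.N i xs)))

    𝔼-N : ∀ t v → X.𝔼 t v (λ xs → fromℕ (X.N i xs)) ≡ visits t v
    𝔼-N zero          v = refl
    -- A trajectory of length 1 makes no transition, so the average in `visits 1` is inserted as an
    -- average of zeros.
    𝔼-N (suc zero)    v = trans (fromℕ-N-∷ v []) (cong (𝟙 (i ≟ᶠ v) ℚ.+_) (sym (avg-const 0ℚ v)))
    𝔼-N (suc (suc t)) v = begin
      avg (λ u → X.𝔼 (suc t) u (λ xs → fromℕ (X.N i (v ∷ xs)))) v
        ≡⟨ avg-cong (λ u → 𝔼-cong (suc t) u (fromℕ-N-∷ v)) v ⟩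
      avg (λ u → X.𝔼 (suc t) u (λ xs → 𝟙 (i ≟ᶠ v) ℚ.+ fromℕ (X.N i xs))) v
        ≡⟨ avg-cong (λ u → trans (𝔼-+ (suc t) u (𝟙 (i ≟ᶠ v)) (λ xs → fromℕ (X.N i xs))) (cong (𝟙 (i ≟ᶠ v) ℚ.+_) (𝔼-N (suc t) u))) v ⟩
      avg (λ u → 𝟙 (i ≟ᶠ v) ℚ.+ visits (suc t) u) v
        ≡⟨ avg-+ (λ _ → 𝟙 (i ≟ᶠ v)) (visits (suc t)) v ⟩
      avg (λ _ → 𝟙 (i ≟ᶠ v)) v ℚ.+ avg (visits (suc t)) v
        ≡⟨ cong (ℚ._+ avg (visits (suc t)) v) (avg-const (𝟙 (i ≟ᶠ v)) v) ⟩
      visits (2 + t) v ∎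
      where open ≡-Reasoning

    visits-nonneg : ∀ t v → 0ℚ ≤ visits t v
    visits-nonneg zero    v = ℚ.≤-refl
    visits-nonneg (suc t) v = +-nonneg (𝟙-nonneg (i ≟ᶠ v)) (avg-nonneg (visits-nonneg t) v)

    -- Unfolding `visits (suc t)` turns this into the subsolution inequality with a unit source at
    -- `i`.
    visits-mono : ∀ t v → visits t v ≤ visits (suc t) v
    visits-mono zero    v = visits-nonneg 1 v
    visits-mono (suc t) v = ℚ.+-monoʳ-≤ (𝟙 (i ≟ᶠ v)) (avg-mono (visits-mono t) v)

    -- The sum runs over starting vertices. Each further unit of time contributes the indicator of
    -- `i`, of total 1, and averaging preserves totals by stationarity.
    ∑-visits : ∀ t → ∑ (visits t) ≡ fromℕ t
    ∑-visits zero    = ∑-zero n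
    ∑-visits (suc t) = begin
      ∑ (λ v → 𝟙 (i ≟ᶠ v) ℚ.+ avg (visits t) v)       ≡⟨ ∑-distrib-+ (λ v → 𝟙 (i ≟ᶠ v)) (avg (visits t)) ⟩
      ∑ (λ v → 𝟙 (i ≟ᶠ v)) ℚ.+ ∑ (avg (visits t))     ≡⟨ cong₂ ℚ._+_ ∑-𝟙 (trans (∑-avg (visits t)) (∑-visits t)) ⟩
      1ℚ ℚ.+ fromℕ t                                  ≡⟨ sym (fromℕ-+ 1 t) ⟩
      fromℕ (suc t)                                   ∎
      where
      open ≡-Reasoning
      ∑-𝟙 : ∑ (λ v → 𝟙 (i ≟ᶠ v)) ≡ 1ℚ
      ∑-𝟙 = trans (sum-cong-≗ (λ v → sym (ℚ.*-identityʳ (𝟙 (i ≟ᶠ v))))) (∑-δ i (λ _ → 1ℚ))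

  module Hitting (A : Subset n) where

    inside? : Fin n → ℚ
    inside? v = 𝟙 (v ∈? A)

    -- The probability of first being outside A at time k ≥ 0.
    exitLaw : ℕ → Fin n → ℚ
    exitLaw zero    v = 𝟙 (v ∈? ∁ A)
    exitLaw (suc k) v = inside? v ℚ.* avg (exitLaw k) v

    𝔼-firstIndex : ∀ k v → X.𝔼 (suc k) v (λ xs → 𝟙 (≡-dec ℕ._≟_ (X.firstIndex (∁ A) xs) (just k))) ≡ exitLaw k v
    𝔼-firstIndex zero v with v ∈? ∁ A
    ... | yes _ = refl
    ... | no _  = refl
    𝔼-firstIndex (suc k) v with v ∈? ∁ A
    ... | yes v∈∁A = begin
      avg (λ u → X.𝔼 (suc k) u (λ _ → 0ℚ)) v  ≡⟨ avg-cong (λ u → 𝔼-const (suc k) u 0ℚ) v ⟩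
      avg (λ _ → 0ℚ) v                        ≡⟨ avg-const 0ℚ v ⟩
      0ℚ                                      ≡⟨ sym (ℚ.*-zeroˡ (avg (exitLaw k) v)) ⟩
      0ℚ ℚ.* avg (exitLaw k) v                ≡⟨ cong (ℚ._* avg (exitLaw k) v) (sym (𝟙-no (v ∈? A) (x∈∁p⇒x∉p v∈∁A))) ⟩
      exitLaw (suc k) v                       ∎
      where open ≡-Reasoning
    ... | no v∉∁A = begin
      avg (λ u → X.𝔼 (suc k) u (λ xs → 𝟙 (≡-dec ℕ._≟_ (Maybe.map suc (X.firstIndex (∁ A) xs)) (just (suc k))))) v
        ≡⟨ avg-cong (λ u → trans (𝔼-cong (suc k) u (λ xs → 𝟙-map-suc (X.firstIndex (∁ A) xs) k)) (𝔼-firstIndex k u)) v ⟩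
      avg (exitLaw k) v
        ≡⟨ sym (ℚ.*-identityˡ (avg (exitLaw k) v)) ⟩
      1ℚ ℚ.* avg (exitLaw k) v
        ≡⟨ cong (ℚ._* avg (exitLaw k) v) (sym (𝟙-yes (v ∈? A) (x∉∁p⇒x∈p v∉∁A))) ⟩
      exitLaw (suc k) v ∎
      where open ≡-Reasoning

    -- `T` ignores time 0 whereas `exitLaw` includes it; they agree because a walk from `i ∈ A` is
    -- not outside `A` at time 0.
    ℙ[T≡]-exitLaw : ∀ {i} → i ∈ A → ∀ k → X.ℙ[T≡] i (∁ A) k ≡ exitLaw k i
    ℙ[T≡]-exitLaw {i} i∈A zero    = sym (𝟙-no (i ∈? ∁ A) (x∈p⇒x∉∁p i∈A))
    ℙ[T≡]-exitLaw {i} i∈A (suc k) = begin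
      avg (λ u → X.𝔼 (suc k) u (λ xs → 𝟙 (≡-dec ℕ._≟_ (Maybe.map suc (X.firstIndex (∁ A) xs)) (just (suc k))))) i
        ≡⟨ avg-cong (λ u → trans (𝔼-cong (suc k) u (λ xs → 𝟙-map-suc (X.firstIndex (∁ A) xs) k)) (𝔼-firstIndex k u)) i ⟩
      avg (exitLaw k) i
        ≡⟨ sym (ℚ.*-identityˡ (avg (exitLaw k) i)) ⟩
      1ℚ ℚ.* avg (exitLaw k) i
        ≡⟨ cong (ℚ._* avg (exitLaw k) i) (sym (𝟙-yes (i ∈? A) i∈A)) ⟩
      exitLaw (suc k) i ∎
      where open ≡-Reasoning

    -- The expectation of the minimum of m and the first time outside A.
    truncatedTime : ℕ → Fin n → ℚ
    truncatedTime zero    v = 0ℚ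
    truncatedTime (suc m) v = inside? v ℚ.* (1ℚ ℚ.+ avg (truncatedTime m) v)

    truncatedTime-nonneg : ∀ m v → 0ℚ ≤ truncatedTime m v
    truncatedTime-nonneg zero    v = ℚ.≤-refl
    truncatedTime-nonneg (suc m) v = *-nonneg (𝟙-nonneg (v ∈? A)) (+-nonneg 0≤1 (avg-nonneg (truncatedTime-nonneg m) v))

    truncatedTime-mono : ∀ m v → truncatedTime m v ≤ truncatedTime (suc m) v
    truncatedTime-mono zero    v = truncatedTime-nonneg 1 v
    truncatedTime-mono (suc m) v = *-monoˡ (𝟙-nonneg (v ∈? A)) (ℚ.+-monoʳ-≤ 1ℚ (avg-mono (truncatedTime-mono m) v))

    truncatedTime-outside : ∀ m {v} → v ∉ A → truncatedTime m v ≡ 0ℚ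
    truncatedTime-outside zero    v∉A = refl
    truncatedTime-outside (suc m) {v} v∉A =
      trans (cong (ℚ._* (1ℚ ℚ.+ avg (truncatedTime m) v)) (𝟙-no (v ∈? A) v∉A)) (ℚ.*-zeroˡ (1ℚ ℚ.+ avg (truncatedTime m) v))

    truncatedTime-subsolution : ∀ m {v} → v ∈ A → truncatedTime m v ≤ 1ℚ ℚ.+ avg (truncatedTime m) v
    truncatedTime-subsolution m {v} v∈A = ℚ.≤-trans (truncatedTime-mono m v) (ℚ.≤-reflexive
      (trans (cong (ℚ._* (1ℚ ℚ.+ avg (truncatedTime m) v)) (𝟙-yes (v ∈? A) v∈A)) (ℚ.*-identityˡ (1ℚ ℚ.+ avg (truncatedTime m) v))))

    -- For the exit time `T` these are `ℙ(T < m)` and `𝔼(T; T < m)`.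
    mass mean : ℕ → Fin n → ℚ
    mass m v = ∑[ m ] (λ k → exitLaw k v)
    mean m v = ∑[ m ] (λ k → fromℕ k ℚ.* exitLaw k v)

    exitLaw-nonneg : ∀ k v → 0ℚ ≤ exitLaw k v
    exitLaw-nonneg zero    v = 𝟙-nonneg (v ∈? ∁ A)
    exitLaw-nonneg (suc k) v = *-nonneg (𝟙-nonneg (v ∈? A)) (avg-nonneg (exitLaw-nonneg k) v)

    mean-nonneg : ∀ m v → 0ℚ ≤ mean m v
    mean-nonneg m v = ∑-nonneg {m} (λ k → *-nonneg (fromℕ-nonneg (toℕ k)) (exitLaw-nonneg (toℕ k) v))

    avg-∑ : ∀ m (F : ℕ → Fin n → ℚ) v → ∑[ m ] (λ k → avg (F k) v) ≡ avg (λ u → ∑[ m ] (λ k → F k u)) v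
    avg-∑ m F v = trans (∑-comm {m} (λ k u → W v u ℚ.* F (toℕ k) u))
      (sum-cong-≗ (λ u → sym (*-distribˡ-sum {m} (W v u) (λ k → F (toℕ k) u))))

    mass-suc : ∀ m v → mass (suc m) v ≡ 𝟙 (v ∈? ∁ A) ℚ.+ inside? v ℚ.* avg (mass m) v
    mass-suc m v = cong (𝟙 (v ∈? ∁ A) ℚ.+_) (trans
      (sym (*-distribˡ-sum {m} (inside? v) (λ k → avg (exitLaw (toℕ k)) v)))
      (cong (inside? v ℚ.*_) (avg-∑ m exitLaw v)))

    -- First-step analysis: inside `A` the exit time is one more than that of the walk from the next
    -- vertex, and this extra one, summed against the law, produces the `mass` term.
    mean-suc : ∀ m v → mean (suc m) v ≡ inside? v ℚ.* (avg (mean m) v ℚ.+ avg (mass m) v)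
    mean-suc m v = begin
      fromℕ 0 ℚ.* exitLaw 0 v ℚ.+ ∑[ m ] (λ k → fromℕ (suc k) ℚ.* (inside? v ℚ.* avg (exitLaw k) v))
        ≡⟨ cong₂ ℚ._+_ (ℚ.*-zeroˡ (exitLaw 0 v)) (sum-cong-≗ {m} (λ k → term (toℕ k))) ⟩
      0ℚ ℚ.+ ∑[ m ] (λ k → inside? v ℚ.* avg (λ u → fromℕ k ℚ.* exitLaw k u ℚ.+ exitLaw k u) v)
        ≡⟨ ℚ.+-identityˡ _ ⟩
      ∑[ m ] (λ k → inside? v ℚ.* avg (λ u → fromℕ k ℚ.* exitLaw k u ℚ.+ exitLaw k u) v)
        ≡⟨ sym (*-distribˡ-sum {m} (inside? v) (λ k → avg (λ u → fromℕ (toℕ k) ℚ.* exitLaw (toℕ k) u ℚ.+ exitLaw (toℕ k) u) v)) ⟩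
      inside? v ℚ.* ∑[ m ] (λ k → avg (λ u → fromℕ k ℚ.* exitLaw k u ℚ.+ exitLaw k u) v)
        ≡⟨ cong (inside? v ℚ.*_) (avg-∑ m (λ k u → fromℕ k ℚ.* exitLaw k u ℚ.+ exitLaw k u) v) ⟩
      inside? v ℚ.* avg (λ u → ∑[ m ] (λ k → fromℕ k ℚ.* exitLaw k u ℚ.+ exitLaw k u)) v
        ≡⟨ cong (inside? v ℚ.*_) (avg-cong (λ u → ∑-distrib-+ {m} (λ k → fromℕ (toℕ k) ℚ.* exitLaw (toℕ k) u) (λ k → exitLaw (toℕ k) u)) v) ⟩
      inside? v ℚ.* avg (λ u → mean m u ℚ.+ mass m u) v
        ≡⟨ cong (inside? v ℚ.*_) (avg-+ (mean m) (mass m) v) ⟩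
      inside? v ℚ.* (avg (mean m) v ℚ.+ avg (mass m) v) ∎
      where
      open ≡-Reasoning
      term : ∀ k → fromℕ (suc k) ℚ.* (inside? v ℚ.* avg (exitLaw k) v)
                 ≡ inside? v ℚ.* avg (λ u → fromℕ k ℚ.* exitLaw k u ℚ.+ exitLaw k u) v
      term k = begin
        fromℕ (suc k) ℚ.* (inside? v ℚ.* avg (exitLaw k) v)
          ≡⟨ cong (ℚ._* (inside? v ℚ.* avg (exitLaw k) v)) (fromℕ-+ 1 k) ⟩
        (1ℚ ℚ.+ fromℕ k) ℚ.* (inside? v ℚ.* avg (exitLaw k) v)
          ≡⟨ solve 3 (λ c x y → (con 1ℚ :+ c) :* (x :* y) := x :* (c :* y :+ y)) refl (fromℕ k) (inside? v) (avg (exitLaw k) v) ⟩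
        inside? v ℚ.* (fromℕ k ℚ.* avg (exitLaw k) v ℚ.+ avg (exitLaw k) v)
          ≡⟨ cong (λ e → inside? v ℚ.* (e ℚ.+ avg (exitLaw k) v)) (sym (avg-* (fromℕ k) (exitLaw k) v)) ⟩
        inside? v ℚ.* (avg (λ u → fromℕ k ℚ.* exitLaw k u) v ℚ.+ avg (exitLaw k) v)
          ≡⟨ cong (inside? v ℚ.*_) (sym (avg-+ (λ u → fromℕ k ℚ.* exitLaw k u) (exitLaw k) v)) ⟩
        inside? v ℚ.* avg (λ u → fromℕ k ℚ.* exitLaw k u ℚ.+ exitLaw k u) v ∎

    mass≤1 : ∀ m v → mass m v ≤ 1ℚ
    mass≤1 zero    v = 0≤1
    mass≤1 (suc m) v = subst (_≤ 1ℚ) (sym (mass-suc m v)) bound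
      where
      avg≤1 : avg (mass m) v ≤ 1ℚ
      avg≤1 = subst (avg (mass m) v ≤_) (avg-const 1ℚ v) (avg-mono (mass≤1 m) v)
      bound : 𝟙 (v ∈? ∁ A) ℚ.+ inside? v ℚ.* avg (mass m) v ≤ 1ℚ
      bound with v ∈? A
      ... | yes v∈A = subst (_≤ 1ℚ)
        (trans (solve 1 (λ x → x := con 0ℚ :+ con 1ℚ :* x) refl (avg (mass m) v))
               (cong (ℚ._+ 1ℚ ℚ.* avg (mass m) v) (sym (𝟙-no (v ∈? ∁ A) (x∈p⇒x∉∁p v∈A))))) avg≤1
      ... | no  _   = subst (_≤ 1ℚ)
        (solve 2 (λ x y → x := x :+ con 0ℚ :* y) refl (𝟙 (v ∈? ∁ A)) (avg (mass m) v)) (𝟙≤1 (v ∈? ∁ A))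

    -- This is `𝔼 min(T, m) = 𝔼(T; T < m) + m ℙ(T ≥ m)`, linking the recursively defined truncated
    -- time to the law of `T`. Both summands are nonnegative, so a bound on truncated times bounds
    -- the partial means and the tails alike.
    truncatedTime-decomposition : ∀ m v → mean m v ℚ.+ fromℕ m ℚ.* (1ℚ ℚ.- mass m v) ≡ truncatedTime m v
    truncatedTime-decomposition zero    v = refl
    truncatedTime-decomposition (suc m) v = begin
      mean (suc m) v ℚ.+ fromℕ (suc m) ℚ.* (1ℚ ℚ.- mass (suc m) v)
        ≡⟨ cong₂ (λ x y → x ℚ.+ y) (mean-suc m v) (cong₂ (λ c e → c ℚ.* (1ℚ ℚ.- e)) (fromℕ-+ 1 m) (mass-suc m v)) ⟩
      inside? v ℚ.* (x ℚ.+ y) ℚ.+ (1ℚ ℚ.+ fromℕ m) ℚ.* (1ℚ ℚ.- (𝟙 (v ∈? ∁ A) ℚ.+ inside? v ℚ.* y))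
        ≡⟨ cong (λ e → inside? v ℚ.* (x ℚ.+ y) ℚ.+ (1ℚ ℚ.+ fromℕ m) ℚ.* (1ℚ ℚ.- (e ℚ.+ inside? v ℚ.* y))) complement ⟩
      inside? v ℚ.* (x ℚ.+ y) ℚ.+ (1ℚ ℚ.+ fromℕ m) ℚ.* (1ℚ ℚ.- ((1ℚ ℚ.- inside? v) ℚ.+ inside? v ℚ.* y))
        ≡⟨ solve 4 (λ z x y c → z :* (x :+ y) :+ (con 1ℚ :+ c) :* (con 1ℚ :- ((con 1ℚ :- z) :+ z :* y))
                       := z :* (con 1ℚ :+ (x :+ c :* (con 1ℚ :- y)))) refl (inside? v) x y (fromℕ m) ⟩
      inside? v ℚ.* (1ℚ ℚ.+ (x ℚ.+ fromℕ m ℚ.* (1ℚ ℚ.- y)))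
        ≡⟨ cong (λ e → inside? v ℚ.* (1ℚ ℚ.+ e)) average ⟩
      truncatedTime (suc m) v ∎
      where
      open ≡-Reasoning
      x = avg (mean m) v
      y = avg (mass m) v
      complement : 𝟙 (v ∈? ∁ A) ≡ 1ℚ ℚ.- inside? v
      complement with v ∈? A
      ... | yes v∈A = 𝟙-no (v ∈? ∁ A) (x∈p⇒x∉∁p v∈A)
      ... | no v∉A  = 𝟙-yes (v ∈? ∁ A) (x∉p⇒x∈∁p v∉A)
      average : x ℚ.+ fromℕ m ℚ.* (1ℚ ℚ.- y) ≡ avg (truncatedTime m) v
      average = begin
        x ℚ.+ fromℕ m ℚ.* (1ℚ ℚ.- y)
          ≡⟨ cong (λ e → x ℚ.+ fromℕ m ℚ.* (e ℚ.- y)) (sym (avg-const 1ℚ v)) ⟩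
        x ℚ.+ fromℕ m ℚ.* (avg (λ _ → 1ℚ) v ℚ.- y)
          ≡⟨ cong (λ e → x ℚ.+ fromℕ m ℚ.* e) difference ⟩
        x ℚ.+ fromℕ m ℚ.* avg (λ u → 1ℚ ℚ.- mass m u) v
          ≡⟨ cong (x ℚ.+_) (sym (avg-* (fromℕ m) (λ u → 1ℚ ℚ.- mass m u) v)) ⟩
        x ℚ.+ avg (λ u → fromℕ m ℚ.* (1ℚ ℚ.- mass m u)) v
          ≡⟨ sym (avg-+ (mean m) (λ u → fromℕ m ℚ.* (1ℚ ℚ.- mass m u)) v) ⟩
        avg (λ u → mean m u ℚ.+ fromℕ m ℚ.* (1ℚ ℚ.- mass m u)) v
          ≡⟨ avg-cong (truncatedTime-decomposition m) v ⟩
        avg (truncatedTime m) v ∎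
        where
        difference : avg (λ _ → 1ℚ) v ℚ.- y ≡ avg (λ u → 1ℚ ℚ.- mass m u) v
        difference = sym (avg-- (λ _ → 1ℚ) (mass m) v)

    mean-≤ : ∀ m v → mean m v ≤ truncatedTime m v
    mean-≤ m v = ≤-from-slack (fromℕ m ℚ.* (1ℚ ℚ.- mass m v))
      (*-nonneg (fromℕ-nonneg m) (slack (mass≤1 m v))) (truncatedTime-decomposition m v)

    tail-≤ : ∀ m v → fromℕ m ℚ.* (1ℚ ℚ.- mass m v) ≤ truncatedTime m v
    tail-≤ m v = ≤-from-slack (mean m v) (mean-nonneg m v)
      (trans (ℚ.+-comm (fromℕ m ℚ.* (1ℚ ℚ.- mass m v)) (mean m v)) (truncatedTime-decomposition m v))

    -- The partial means are at most `K`, and the tails force almost sure finiteness. The gap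
    -- between `K` and `L` provides the strict inequality.
    exit-expectationBelow : ∀ {i} → i ∈ A → ∀ {K L} → K < L → (∀ m → truncatedTime m i ≤ fromℕ K) →
      ExpectationBelow (X.ℙ[T≡] i (∁ A)) (fromℕ L)
    exit-expectationBelow {i} i∈A {K} K<L bound =
        finite
      , fromℕ K , fromℕ-mono-< K<L
      , λ m → ℚ.≤-trans (ℚ.≤-reflexive (sum-cong-≗ {m} (λ k → cong (fromℕ (toℕ k) ℚ.*_) (ℙ[T≡]-exitLaw i∈A (toℕ k)))))
                        (ℚ.≤-trans (mean-≤ m i) (bound m))
      where
      finite : AlmostSurelyFinite (X.ℙ[T≡] i (∁ A))
      -- Choosing `m` with `K < m e` turns the tail estimate `m (1 - mass m i) ≤ K` into
      -- `1 - mass m i < e` after cancelling `m`.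
      finite e 0<e with archimedean K e 0<e
      ... | m , K<me = m , subst (1ℚ ℚ.- e ℚ.<_) (sym (sum-cong-≗ {m} (λ k → ℙ[T≡]-exitLaw i∈A (toℕ k))))
        (subst₂ ℚ._<_ (solve 2 (λ x e → con 1ℚ :- x :+ (x :- e) := con 1ℚ :- e) refl (mass m i) e)
                      (solve 2 (λ x e → e :+ (x :- e) := x) refl (mass m i) e)
          (ℚ.+-monoˡ-< (mass m i ℚ.- e)
            (ℚ.*-cancelˡ-<-nonNeg (fromℕ m) {{ℚ.nonNegative (fromℕ-nonneg m)}}
              (ℚ.≤-<-trans (ℚ.≤-trans (tail-≤ m i) (bound m)) K<me))))

-- Resistance of shortest paths to the complement of `A`.

module Resistance {n} (G : SimpleGraph n) {W : Fin n → Fin n → ℚ} (isSymmetricChain : IsSymmetricChain W)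
  (degree : Fin n → ℚ) (degree-∑ : ∀ v → degree v ≡ ∑ (λ u → 𝟙 (adj? G v u)))
  (Δ : ℚ) (degree-≤-Δ : ∀ v → degree v ≤ Δ)
  (edge-resistance : ∀ {u v} → Adj G u v → ∃[ d ] W u v ℚ.* d ≡ 1ℚ × d ≤ degree u ℚ.+ degree v × d ≤ Δ) where

  open IsSymmetricChain isSymmetricChain
  open SymmetricChain isSymmetricChain

  degree-nonneg : ∀ v → 0ℚ ≤ degree v
  degree-nonneg v = subst (0ℚ ≤_) (sym (degree-∑ v)) (∑-nonneg (λ u → 𝟙-nonneg (adj? G v u)))

  Δ-nonneg : Fin n → 0ℚ ≤ Δ
  Δ-nonneg v = ℚ.≤-trans (degree-nonneg v) (degree-≤-Δ v)

  module Balls (A : Subset n) where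

    -- The vertices within graph distance `m` of the complement of `A`.
    Ball : ℕ → Fin n → Set
    Ball zero    v = v ∉ A
    Ball (suc m) v = Ball m v ⊎ ∃[ u ] Adj G v u × Ball m u

    abstract
      ball? : ∀ m v → Dec (Ball m v)
      ball? zero    v = ¬? (v ∈? A)
      ball? (suc m) v = ball? m v ⊎-dec any? (λ u → adj? G v u ×-dec ball? m u)

    χ : ℕ → Fin n → ℚ
    χ m v = 𝟙 (ball? m v)

    ballSize : ℕ → ℚ
    ballSize m = ∑ (χ m)

    ballSize-mono : ∀ m → ballSize m ≤ ballSize (suc m)
    ballSize-mono m = ∑-mono (λ v → 𝟙-mono (ball? m v) (ball? (suc m) v) inj₁)

    ballSize-complement : fromℕ ∣ A ∣ ℚ.+ ballSize 0 ≡ fromℕ n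
    ballSize-complement = begin
      fromℕ ∣ A ∣ ℚ.+ ballSize 0                               ≡⟨ cong (ℚ._+ ballSize 0) (∣∣-∑ A) ⟩
      ∑ (λ v → inA v) ℚ.+ ∑ (χ 0)                              ≡⟨ sym (∑-distrib-+ inA (χ 0)) ⟩
      ∑ (λ v → inA v ℚ.+ χ 0 v)                                ≡⟨ sum-cong-≗ (λ v → pointwise v) ⟩
      ∑ {n} (λ _ → 1ℚ)                                         ≡⟨ ∑-const n 1ℚ ⟩
      fromℕ n ℚ.* 1ℚ                                           ≡⟨ ℚ.*-identityʳ (fromℕ n) ⟩
      fromℕ n                                                  ∎
      where
      open ≡-Reasoning
      inA : Fin n → ℚ
      inA v = if Vec.lookup A v then 1ℚ else 0ℚ
      pointwise : ∀ v → inA v ℚ.+ χ 0 v ≡ 1ℚ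
      pointwise v with Vec.lookup A v in eq
      ... | true  = cong (1ℚ ℚ.+_) (𝟙-no (ball? 0 v) (λ v∉A → v∉A (lookup⇒[]= v A eq)))
      ... | false = cong (0ℚ ℚ.+_) (𝟙-yes (ball? 0 v) (λ v∈A → contradiction (trans (sym eq) ([]=⇒lookup v∈A)) (λ ())))

    ballSize-≤ : ∀ m → ballSize m ≤ fromℕ n
    ballSize-≤ m = ℚ.≤-trans (∑-mono (λ v → 𝟙≤1 (ball? m v)))
      (ℚ.≤-reflexive (trans (∑-const n 1ℚ) (ℚ.*-identityʳ (fromℕ n))))

    -- All neighbours of a vertex at distance m + 2 from the complement of A
    -- lie at distance m + 1, m + 2 or m + 3.
    degree-≤-annulus : ∀ m {v} → Ball (2 + m) v → ¬ Ball (1 + m) v → degree v ℚ.+ ballSize m ≤ ballSize (3 + m)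
    degree-≤-annulus m {v} v∈ v∉ = begin
      degree v ℚ.+ ballSize m                   ≡⟨ cong (ℚ._+ ballSize m) (degree-∑ v) ⟩
      ∑ (λ u → 𝟙 (adj? G v u)) ℚ.+ ballSize m   ≡⟨ sym (∑-distrib-+ (λ u → 𝟙 (adj? G v u)) (χ m)) ⟩
      ∑ (λ u → 𝟙 (adj? G v u) ℚ.+ χ m u)        ≤⟨ ∑-mono pointwise ⟩
      ballSize (3 + m)                          ∎
      where
      open ℚ.≤-Reasoning
      pointwise : ∀ u → 𝟙 (adj? G v u) ℚ.+ χ m u ≤ χ (3 + m) u
      pointwise u = 𝟙-disjoint (adj? G v u) (ball? m u) (ball? (3 + m) u)
        (λ vu u∈ → v∉ (inj₂ (u , vu , u∈))) (λ vu → inj₂ (v , symm G vu , v∈)) (inj₁ ∘ inj₁ ∘ inj₁)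

    reach : ∀ {v x} → Star (Adj G) v x → x ∉ A → ∃[ m ] Ball m v
    reach ε         x∉A = 0 , x∉A
    reach {v} (_◅_ {j = u} vu ux) x∉A with reach ux x∉A
    ... | m , u∈ = suc m , inj₂ (u , vu , u∈)

    -- Descending through the balls finds the exact distance `k + 1` of `v`. With it no shortest
    -- path has to be built as an object: each level supplies the next neighbour.
    first-ball : ∀ m {v} → v ∈ A → Ball m v → ∃[ k ] Ball (suc k) v × ¬ Ball k v
    first-ball zero    v∈A v∉A = contradiction v∈A v∉A
    first-ball (suc m) {v} v∈A v∈ with ball? m v
    ... | yes v∈′ = first-ball m v∈A v∈′
    ... | no  v∉  = m , v∈ , v∉

    -- Bounds the resistance of a shortest path from a vertex at distance `m + 1`, plus the degree
    -- of that vertex. At distance 1 one `Δ` is for the edge leaving `A`, the other for the degree.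
    -- A vertex at distance `m + 2` adds its degree twice, and the degree is at most the size of the
    -- annulus around it.
    resistance : ℕ → ℚ
    resistance zero    = 2ℚ ℚ.* Δ
    resistance (suc m) = resistance m ℚ.+ 2ℚ ℚ.* (ballSize (3 + m) ℚ.- ballSize m)

    -- The annuli are three levels thick, so the sum of their sizes telescopes to three ball sizes
    -- at each end.
    resistance-telescoped : ∀ m → resistance m ≡ 2ℚ ℚ.* Δ ℚ.+ 2ℚ ℚ.*
      ((ballSize (2 + m) ℚ.+ ballSize (1 + m) ℚ.+ ballSize m) ℚ.- (ballSize 2 ℚ.+ ballSize 1 ℚ.+ ballSize 0))
    resistance-telescoped zero = solve 2 (λ D B → con 2ℚ :* D := con 2ℚ :* D :+ con 2ℚ :* (B :- B)) refl Δ (ballSize 2 ℚ.+ ballSize 1 ℚ.+ ballSize 0)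
    resistance-telescoped (suc m) = trans (cong (ℚ._+ 2ℚ ℚ.* (ballSize (3 + m) ℚ.- ballSize m)) (resistance-telescoped m))
      (solve 6 (λ D B b₀ b₁ b₂ b₃ →
        con 2ℚ :* D :+ con 2ℚ :* ((b₂ :+ b₁ :+ b₀) :- B) :+ con 2ℚ :* (b₃ :- b₀)
        := con 2ℚ :* D :+ con 2ℚ :* ((b₃ :+ b₂ :+ b₁) :- B)) refl
        Δ (ballSize 2 ℚ.+ ballSize 1 ℚ.+ ballSize 0) (ballSize m) (ballSize (1 + m)) (ballSize (2 + m)) (ballSize (3 + m)))

    module _ (f : Fin n → ℚ) (off : ∀ {v} → v ∉ A → f v ≡ 0ℚ) (l : ℚ) where

      energyWithin : ℕ → ℚ
      energyWithin m = energyOn (χ m) f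

      cross : ∀ m {v u} → ¬ Ball m v → Ball m u → Adj G v u →
        energyWithin m ℚ.+ 2ℚ ℚ.* edgeEnergy f v u ≤ energyWithin (suc m)
      cross m {v} {u} v∉ u∈ vu = energyOn-grow f (λ w → 𝟙-nonneg (ball? m w))
        (λ w → 𝟙-mono (ball? m w) (ball? (suc m) w) inj₁)
        (λ { refl → irrefl G refl vu })
        (𝟙-no (ball? m v) v∉) (𝟙-yes (ball? (suc m) v) (inj₂ (u , vu , u∈))) (𝟙-yes (ball? (suc m) u) (inj₁ u∈))

      -- Weighted AM-GM is applied to one edge per level, starting from `f u = 0` outside `A`. The
      -- edge `vu` costs at most `degree v + degree u`; the degree carried by the previous bound
      -- pays for `u`, and `degree v` is carried on. The energy is restricted to the current ball:
      -- `v` lies outside the previous ball, so the energy of `vu` has not been spent before.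
      level-bound : ∀ m {v} → Ball (suc m) v → ¬ Ball m v →
        2ℚ ℚ.* (2ℚ ℚ.* (l ℚ.* f v) ℚ.+ l ℚ.* l ℚ.* degree v) ≤ 2ℚ ℚ.* (l ℚ.* l ℚ.* resistance m) ℚ.+ energyWithin (suc m)
      level-bound m (inj₁ v∈) v∉ = contradiction v∈ v∉
      level-bound zero {v} (inj₂ (u , vu , u∉A)) v∉ with edge-resistance vu
      ... | d , wd , _ , d≤Δ = subst (λ R → 2ℚ ℚ.* (2ℚ ℚ.* (l ℚ.* f v) ℚ.+ l ℚ.* l ℚ.* degree v) ≤ 2ℚ ℚ.* R ℚ.+ energyWithin 1)
        (solve 2 (λ l D → con 2ℚ :* (l :* l :* D) := l :* l :* (con 2ℚ :* D)) refl l Δ)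
        (base-step {X = l ℚ.* f v} {d = l ℚ.* l ℚ.* d} {e = edgeEnergy f v u} {D = l ℚ.* l ℚ.* Δ} {E₀ = energyWithin 0} {E₁ = energyWithin 1}
          (subst (λ y → 2ℚ ℚ.* y ≤ l ℚ.* l ℚ.* d ℚ.+ edgeEnergy f v u) drop (scaled-AM-GM l (f v ℚ.- f u) (nonneg v u) wd))
          (*-monoˡ (square-nonneg l) d≤Δ) (*-monoˡ (square-nonneg l) (degree-≤-Δ v))
          (cross 0 v∉ u∉A vu) (energyOn-nonneg f (λ w → 𝟙-nonneg (ball? 0 w))))
        where
        drop : l ℚ.* (f v ℚ.- f u) ≡ l ℚ.* f v
        drop = trans (cong (λ y → l ℚ.* (f v ℚ.- y)) (off u∉A))
          (solve 2 (λ l x → l :* (x :- con 0ℚ) := l :* x) refl l (f v))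
      level-bound (suc m) {v} v∈@(inj₂ (u , vu , u∈)) v∉ with edge-resistance vu
      ... | d , wd , d≤sum , _ = subst (λ R → 2ℚ ℚ.* (2ℚ ℚ.* (l ℚ.* f v) ℚ.+ l ℚ.* l ℚ.* degree v) ≤ 2ℚ ℚ.* R ℚ.+ energyWithin (2 + m))
        (solve 3 (λ l r b → l :* l :* r :+ con 2ℚ :* (l :* l :* b) := l :* l :* (r :+ con 2ℚ :* b)) refl l (resistance m) annulus)
        (inductive-step {X = l ℚ.* f v} {Y = l ℚ.* f u} {d = l ℚ.* l ℚ.* d} {e = edgeEnergy f v u}
          {R = l ℚ.* l ℚ.* resistance m} {β = l ℚ.* l ℚ.* annulus} {E₁ = energyWithin (1 + m)} {E₂ = energyWithin (2 + m)}
          -- Were `u` within distance `m`, its neighbour `v` would be within distance `m + 1`.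
          (level-bound m u∈ (λ u∈′ → v∉ (inj₂ (u , vu , u∈′))))
          (subst (λ y → 2ℚ ℚ.* y ≤ l ℚ.* l ℚ.* d ℚ.+ edgeEnergy f v u)
            (solve 3 (λ l x y → l :* (x :- y) := l :* x :- l :* y) refl l (f v) (f u))
            (scaled-AM-GM l (f v ℚ.- f u) (nonneg v u) wd))
          (subst (l ℚ.* l ℚ.* d ≤_) (ℚ.*-distribˡ-+ (l ℚ.* l) (degree v) (degree u)) (*-monoˡ (square-nonneg l) d≤sum))
          (*-monoˡ (square-nonneg l) degree≤)
          (cross (suc m) v∉ u∈ vu))
        where
        annulus = ballSize (3 + m) ℚ.- ballSize m
        degree≤ : degree v ≤ annulus
        degree≤ = ≤-from-slack (ballSize (3 + m) ℚ.- (degree v ℚ.+ ballSize m)) (slack (degree-≤-annulus m v∈ v∉))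
          (solve 3 (λ x y z → x :+ (y :- (x :+ z)) := y :- z) refl (degree v) (ballSize (3 + m)) (ballSize m))

    -- Each of the three outer balls has at most `n` vertices and each of the three inner ones at
    -- least `n - |A|`, so the telescoped difference is at most `3 |A|`, and it enters with a factor
    -- 2.
    resistance-≤ : ∀ m → resistance m ≤ fromℕ 6 ℚ.* fromℕ ∣ A ∣ ℚ.+ 2ℚ ℚ.* Δ
    resistance-≤ m = subst (_≤ fromℕ 6 ℚ.* fromℕ ∣ A ∣ ℚ.+ 2ℚ ℚ.* Δ) (sym (resistance-telescoped m))
      (bound {fromℕ ∣ A ∣} {b₁ = ballSize 1} {ballSize 2} {ballSize m} {ballSize (1 + m)} {ballSize (2 + m)} ballSize-complement (ballSize-≤ (2 + m)) (ballSize-≤ (1 + m)) (ballSize-≤ m)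
        (ballSize-mono 0) (ℚ.≤-trans (ballSize-mono 0) (ballSize-mono 1)))
      where
      bound : ∀ {a N b₀ b₁ b₂ c₀ c₁ c₂} → a ℚ.+ b₀ ≡ N → c₂ ≤ N → c₁ ≤ N → c₀ ≤ N → b₀ ≤ b₁ → b₀ ≤ b₂ →
        2ℚ ℚ.* Δ ℚ.+ 2ℚ ℚ.* ((c₂ ℚ.+ c₁ ℚ.+ c₀) ℚ.- (b₂ ℚ.+ b₁ ℚ.+ b₀)) ≤ fromℕ 6 ℚ.* a ℚ.+ 2ℚ ℚ.* Δ
      bound {a} {_} {b₀} {b₁} {b₂} {c₀} {c₁} {c₂} refl c₂≤ c₁≤ c₀≤ b₀≤b₁ b₀≤b₂ = ≤-from-slack
        (2ℚ ℚ.* ((a ℚ.+ b₀ ℚ.- c₂) ℚ.+ (a ℚ.+ b₀ ℚ.- c₁) ℚ.+ (a ℚ.+ b₀ ℚ.- c₀) ℚ.+ (b₁ ℚ.- b₀) ℚ.+ (b₂ ℚ.- b₀)))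
        (*-nonneg 0≤2 (+-nonneg (+-nonneg (+-nonneg (+-nonneg (slack c₂≤) (slack c₁≤)) (slack c₀≤)) (slack b₀≤b₁)) (slack b₀≤b₂)))
        (solve 8 (λ D a b₀ b₁ b₂ c₀ c₁ c₂ →
          con 2ℚ :* D :+ con 2ℚ :* ((c₂ :+ c₁ :+ c₀) :- (b₂ :+ b₁ :+ b₀))
            :+ con 2ℚ :* ((a :+ b₀ :- c₂) :+ (a :+ b₀ :- c₁) :+ (a :+ b₀ :- c₀) :+ (b₁ :- b₀) :+ (b₂ :- b₀))
          := con (fromℕ 6) :* a :+ con 2ℚ :* D) refl Δ a b₀ b₁ b₂ c₀ c₁ c₂)

    -- The level bound is used at the exact distance of `i`: its degree term is dropped and the
    -- energy in the ball is enlarged to the whole energy. The overall factor 2, which reflects that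
    -- the energy counts ordered pairs, is then cancelled.
    potential-bound : Connected G → ∀ {x} → x ∉ A → ∀ {f g : Fin n → ℚ} l →
      (∀ v → 0ℚ ≤ f v) → (∀ {v} → v ∉ A → f v ≡ 0ℚ) → (∀ {v} → v ∈ A → f v ≤ g v ℚ.+ avg f v) →
      ∀ {i} → i ∈ A →
      2ℚ ℚ.* (l ℚ.* f i) ≤ l ℚ.* l ℚ.* (fromℕ 6 ℚ.* fromℕ ∣ A ∣ ℚ.+ 2ℚ ℚ.* Δ) ℚ.+ ∑ (λ v → f v ℚ.* g v)
    potential-bound connected {x} x∉A {f} {g} l 0≤f off sub {i} i∈A
      with reach (connected i x) x∉A
    ... | m , i∈Ball with first-ball m i∈A i∈Ball
    ... | k , i∈ , i∉ = ℚ.*-cancelˡ-≤-pos 2ℚ (begin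
      2ℚ ℚ.* (2ℚ ℚ.* (l ℚ.* f i))
        ≤⟨ *-monoˡ 0≤2 (≤-from-slack {2ℚ ℚ.* (l ℚ.* f i)} (l ℚ.* l ℚ.* degree i) (*-nonneg (square-nonneg l) (degree-nonneg i)) refl) ⟩
      2ℚ ℚ.* (2ℚ ℚ.* (l ℚ.* f i) ℚ.+ l ℚ.* l ℚ.* degree i)
        ≤⟨ level-bound f off l k i∈ i∉ ⟩
      2ℚ ℚ.* (l ℚ.* l ℚ.* resistance k) ℚ.+ energyWithin f off l (suc k)
        ≤⟨ ℚ.+-mono-≤ (*-monoˡ 0≤2 (*-monoˡ (square-nonneg l) (resistance-≤ k)))
             (ℚ.≤-trans (energyOn-≤-energy f (λ v → 𝟙-nonneg (ball? (suc k) v)) (λ v → 𝟙≤1 (ball? (suc k) v)))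
                        (energy-subsolution A 0≤f off sub)) ⟩
      2ℚ ℚ.* (l ℚ.* l ℚ.* R) ℚ.+ 2ℚ ℚ.* ∑ (λ v → f v ℚ.* g v)
        ≡⟨ sym (ℚ.*-distribˡ-+ 2ℚ (l ℚ.* l ℚ.* R) (∑ (λ v → f v ℚ.* g v))) ⟩
      2ℚ ℚ.* (l ℚ.* l ℚ.* R ℚ.+ ∑ (λ v → f v ℚ.* g v)) ∎)
      where
      open ℚ.≤-Reasoning
      R = fromℕ 6 ℚ.* fromℕ ∣ A ∣ ℚ.+ 2ℚ ℚ.* Δ

    module _ (connected : Connected G) {x} (x∉A : x ∉ A) where

      killed-time-≤ : ∀ {f : Fin n → ℚ} → (∀ v → 0ℚ ≤ f v) → (∀ {v} → v ∉ A → f v ≡ 0ℚ) →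
        (∀ {v} → v ∈ A → f v ≤ 1ℚ ℚ.+ avg f v) →
        ∀ {i} → i ∈ A → f i ≤ fromℕ ∣ A ∣ ℚ.* (fromℕ 6 ℚ.* fromℕ ∣ A ∣ ℚ.+ 2ℚ ℚ.* Δ)
      killed-time-≤ {f} 0≤f off sub {i} i∈A = ℚ.≤-trans (f≤f[j] i) f[j]≤
        where
        a = fromℕ ∣ A ∣
        R = fromℕ 6 ℚ.* a ℚ.+ 2ℚ ℚ.* Δ
        j : Fin n
        j = argmax f i (allFin n)
        f≤f[j] : ∀ v → f v ≤ f j
        f≤f[j] v = All.lookup (f[xs]≤f[argmax] i (allFin n)) (∈-allFin v)
        0<a : 0ℚ ℚ.< a
        0<a = ℚ.<-≤-trans (ℚ.positive⁻¹ 1ℚ) (fromℕ-mono-≤ (x∈p⇒1≤∣p∣ i∈A))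
        0≤aR : 0ℚ ≤ a ℚ.* R
        0≤aR = *-nonneg (ℚ.<⇒≤ 0<a) (+-nonneg (*-nonneg (fromℕ-nonneg 6) (ℚ.<⇒≤ 0<a)) (*-nonneg 0≤2 (Δ-nonneg i)))
        -- As `f` lives on `A` and is largest at `j`, this absorbs one of the two copies of
        -- `a * f j` on the left of `potential-bound` with `l = a`.
        total : ∑ (λ v → f v ℚ.* 1ℚ) ≤ a ℚ.* f j
        total = begin
          ∑ (λ v → f v ℚ.* 1ℚ)                                            ≤⟨ ∑-mono pointwise ⟩
          ∑ (λ v → (if Vec.lookup A v then 1ℚ else 0ℚ) ℚ.* f j)           ≡⟨ sym (*-distribʳ-sum (f j) (λ v → if Vec.lookup A v then 1ℚ else 0ℚ)) ⟩
          ∑ (λ v → if Vec.lookup A v then 1ℚ else 0ℚ) ℚ.* f j             ≡⟨ cong (ℚ._* f j) (sym (∣∣-∑ A)) ⟩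
          a ℚ.* f j                                                       ∎
          where
          open ℚ.≤-Reasoning
          pointwise : ∀ v → f v ℚ.* 1ℚ ≤ (if Vec.lookup A v then 1ℚ else 0ℚ) ℚ.* f j
          pointwise v with Vec.lookup A v in eq
          ... | true  = subst₂ _≤_ (sym (ℚ.*-identityʳ (f v))) (sym (ℚ.*-identityˡ (f j))) (f≤f[j] v)
          ... | false = ℚ.≤-reflexive (trans (ℚ.*-identityʳ (f v)) (trans
                          (off (λ v∈A → contradiction (trans (sym eq) ([]=⇒lookup v∈A)) (λ ())))
                          (sym (ℚ.*-zeroˡ (f j)))))
        f[j]≤ : f j ≤ a ℚ.* R
        f[j]≤ with j ∈? A
        ... | no  j∉A = subst (_≤ a ℚ.* R) (sym (off j∉A)) 0≤aR
        ... | yes j∈A = ℚ.*-cancelˡ-≤-pos a {{ℚ.positive 0<a}} (≤-from-slack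
          ((a ℚ.* a ℚ.* R ℚ.+ ∑ (λ v → f v ℚ.* 1ℚ) ℚ.- 2ℚ ℚ.* (a ℚ.* f j)) ℚ.+ (a ℚ.* f j ℚ.- ∑ (λ v → f v ℚ.* 1ℚ)))
          (+-nonneg (slack (potential-bound connected x∉A a 0≤f off sub j∈A)) (slack total))
          (solve 4 (λ a R m S → a :* m :+ ((a :* a :* R :+ S :- con 2ℚ :* (a :* m)) :+ (a :* m :- S)) := a :* (a :* R))
            refl a R (f j) (∑ (λ v → f v ℚ.* 1ℚ))))

      -- With a unit source at `i` the sum of `f g` collapses to `f i`, which cancels one of the two
      -- copies of `f i` obtained for `l = 1`.
      killed-visits-≤ : ∀ {f : Fin n → ℚ} {i} → (∀ v → 0ℚ ≤ f v) → (∀ {v} → v ∉ A → f v ≡ 0ℚ) →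
        (∀ {v} → v ∈ A → f v ≤ 𝟙 (i ≟ᶠ v) ℚ.+ avg f v) →
        i ∈ A → f i ≤ fromℕ 6 ℚ.* fromℕ ∣ A ∣ ℚ.+ 2ℚ ℚ.* Δ
      killed-visits-≤ {f} {i} 0≤f off sub i∈A = ≤-from-slack
        (1ℚ ℚ.* 1ℚ ℚ.* R ℚ.+ f i ℚ.- 2ℚ ℚ.* (1ℚ ℚ.* f i))
        (slack (subst (λ S → 2ℚ ℚ.* (1ℚ ℚ.* f i) ≤ 1ℚ ℚ.* 1ℚ ℚ.* R ℚ.+ S)
          (trans (sum-cong-≗ (λ v → ℚ.*-comm (f v) (𝟙 (i ≟ᶠ v)))) (∑-δ i f))
          (potential-bound connected x∉A 1ℚ 0≤f off sub i∈A)))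
        (solve 2 (λ y R → y :+ (con 1ℚ :* con 1ℚ :* R :+ y :- con 2ℚ :* (con 1ℚ :* y)) := R) refl (f i) R)
        where
        R = fromℕ 6 ℚ.* fromℕ ∣ A ∣ ℚ.+ 2ℚ ℚ.* Δ

  -- Bounds for truncated exit times and for expected visits.

  module Bounds (connected : Connected G) where

    truncatedTime-≤ : ∀ {A x i} → x ∉ A → i ∈ A → ∀ m →
      Expectations.Hitting.truncatedTime isSymmetricChain A m i ≤ fromℕ ∣ A ∣ ℚ.* (fromℕ 6 ℚ.* fromℕ ∣ A ∣ ℚ.+ 2ℚ ℚ.* Δ)
    truncatedTime-≤ {A} x∉A i∈A m = Balls.killed-time-≤ A connected x∉A {f = truncatedTime m}
      (truncatedTime-nonneg m) (truncatedTime-outside m) (truncatedTime-subsolution m) i∈A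
      where open Expectations.Hitting isSymmetricChain A

    module _ {i : Fin n} {t : ℕ} {s : ℚ} (0<s : 0ℚ ℚ.< s)
      (6t<s² : fromℕ 6 ℚ.* fromℕ t ℚ.< s ℚ.* s) (t<6n² : fromℕ t ℚ.< fromℕ 6 ℚ.* (fromℕ n ℚ.* fromℕ n)) where

      open Expectations.Visits isSymmetricChain i

      private
        high? : ∀ v → Dec (s ℚ.< visits t v)
        high? v = s ℚ.<? visits t v

        A : Subset n
        A = select high?

        excess : Fin n → ℚ
        excess v = (visits t v ℚ.- s) ℚ.⊔ 0ℚ

        excess-outside : ∀ {v} → v ∉ A → excess v ≡ 0ℚ
        excess-outside {v} v∉A = ℚ.p≤q⇒p⊔q≡q (subst (visits t v ℚ.- s ≤_) (ℚ.+-inverseʳ s)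
          (ℚ.+-monoˡ-≤ (ℚ.- s) (ℚ.≮⇒≥ (λ s<v → v∉A (∈-select⁺ high? s<v)))))

        -- Subtracting the constant `s` commutes with averaging since rows sum to 1, and replacing
        -- the difference by its positive part only increases the average.
        excess-subsolution : ∀ {v} → v ∈ A → excess v ≤ 𝟙 (i ≟ᶠ v) ℚ.+ avg excess v
        excess-subsolution {v} v∈A = begin
          excess v
            ≡⟨ ℚ.p≥q⇒p⊔q≡p (slack (ℚ.<⇒≤ (∈-select⁻ high? v∈A))) ⟩
          visits t v ℚ.- s
            ≤⟨ ℚ.+-monoˡ-≤ (ℚ.- s) (visits-mono t v) ⟩
          𝟙 (i ≟ᶠ v) ℚ.+ avg (visits t) v ℚ.- s
            ≡⟨ ℚ.+-assoc (𝟙 (i ≟ᶠ v)) (avg (visits t) v) (ℚ.- s) ⟩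
          𝟙 (i ≟ᶠ v) ℚ.+ (avg (visits t) v ℚ.- s)
            ≡⟨ cong (λ e → 𝟙 (i ≟ᶠ v) ℚ.+ (avg (visits t) v ℚ.- e)) (sym (avg-const s v)) ⟩
          𝟙 (i ≟ᶠ v) ℚ.+ (avg (visits t) v ℚ.- avg (λ _ → s) v)
            ≡⟨ cong (𝟙 (i ≟ᶠ v) ℚ.+_) (sym (avg-- (visits t) (λ _ → s) v)) ⟩
          𝟙 (i ≟ᶠ v) ℚ.+ avg (λ u → visits t u ℚ.- s) v
            ≤⟨ ℚ.+-monoʳ-≤ (𝟙 (i ≟ᶠ v)) (avg-mono (λ u → ℚ.p≤p⊔q (visits t u ℚ.- s) 0ℚ) v) ⟩
          𝟙 (i ≟ᶠ v) ℚ.+ avg excess v ∎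
          where open ℚ.≤-Reasoning

        Markov : fromℕ ∣ A ∣ ℚ.* s ≤ fromℕ t
        Markov = begin
          fromℕ ∣ A ∣ ℚ.* s                                       ≡⟨ cong (ℚ._* s) (∣∣-∑ A) ⟩
          ∑ (λ v → if Vec.lookup A v then 1ℚ else 0ℚ) ℚ.* s       ≡⟨ *-distribʳ-sum s (λ v → if Vec.lookup A v then 1ℚ else 0ℚ) ⟩
          ∑ (λ v → (if Vec.lookup A v then 1ℚ else 0ℚ) ℚ.* s)     ≤⟨ ∑-mono pointwise ⟩
          ∑ (visits t)                                            ≡⟨ ∑-visits t ⟩
          fromℕ t                                                 ∎
          where
          open ℚ.≤-Reasoning
          pointwise : ∀ v → (if Vec.lookup A v then 1ℚ else 0ℚ) ℚ.* s ≤ visits t v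
          pointwise v with Vec.lookup A v in eq
          ... | true  = subst (_≤ visits t v) (sym (ℚ.*-identityˡ s)) (ℚ.<⇒≤ (∈-select⁻ high? (lookup⇒[]= v A eq)))
          ... | false = subst (_≤ visits t v) (sym (ℚ.*-zeroˡ s)) (visits-nonneg t v)

        -- From `6 x s ≤ 6 t < s²` by cancelling `s`. It is used for `x = |A|`, and for `x = n` to
        -- exclude that every vertex is high.
        6x<s : ∀ x → x ℚ.* s ≤ fromℕ t → fromℕ 6 ℚ.* x ℚ.< s
        6x<s x xs≤t = ℚ.*-cancelʳ-<-nonNeg s {{ℚ.nonNegative (ℚ.<⇒≤ 0<s)}}
          (ℚ.≤-<-trans (subst (_≤ fromℕ 6 ℚ.* fromℕ t) (sym (ℚ.*-assoc (fromℕ 6) x s)) (*-monoˡ (fromℕ-nonneg 6) xs≤t)) 6t<s²)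

        low : ∃[ x ] x ∉ A
        low with any? (λ v → ¬? (high? v))
        ... | yes (x , x-low) = x , λ x∈A → x-low (∈-select⁻ high? x∈A)
        ... | no  all-high    = contradiction (ℚ.<-≤-trans t<6n² 6n²≤t) (ℚ.<-irrefl refl)
          where
          s≤visits : ∀ v → s ≤ visits t v
          s≤visits v with high? v
          ... | yes s<v = ℚ.<⇒≤ s<v
          ... | no  s≮v = contradiction (v , s≮v) all-high
          ns≤t : fromℕ n ℚ.* s ≤ fromℕ t
          ns≤t = subst₂ _≤_ (∑-const n s) (∑-visits t) (∑-mono s≤visits)
          6n²≤t : fromℕ 6 ℚ.* (fromℕ n ℚ.* fromℕ n) ≤ fromℕ t
          6n²≤t = ℚ.≤-trans (ℚ.≤-reflexive (solve 2 (λ c x → c :* (x :* x) := x :* (c :* x)) refl (fromℕ 6) (fromℕ n)))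
            (ℚ.≤-trans (*-monoˡ (fromℕ-nonneg n) (ℚ.<⇒≤ (6x<s (fromℕ n) ns≤t))) ns≤t)

      -- Strictness comes from `6 |A| < s` if `i` is a high vertex, and from `0 < s` otherwise.
      visits-< : visits t i ℚ.< 2ℚ ℚ.* s ℚ.+ 2ℚ ℚ.* Δ
      visits-< with i ∈? A
      ... | yes i∈A = begin-strict
        visits t i                                                 ≡⟨ solve 2 (λ x s → x := (x :- s) :+ s) refl (visits t i) s ⟩
        (visits t i ℚ.- s) ℚ.+ s                                   ≤⟨ ℚ.+-monoˡ-≤ s (ℚ.p≤p⊔q (visits t i ℚ.- s) 0ℚ) ⟩
        excess i ℚ.+ s                                             ≤⟨ ℚ.+-monoˡ-≤ s (Balls.killed-visits-≤ A connected (proj₂ low) {f = excess}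
                                                                        (λ v → ℚ.p≤q⊔p (visits t v ℚ.- s) 0ℚ) excess-outside excess-subsolution i∈A) ⟩
        (fromℕ 6 ℚ.* fromℕ ∣ A ∣ ℚ.+ 2ℚ ℚ.* Δ) ℚ.+ s               <⟨ ℚ.+-monoˡ-< s (ℚ.+-monoˡ-< (2ℚ ℚ.* Δ) (6x<s (fromℕ ∣ A ∣) Markov)) ⟩
        (s ℚ.+ 2ℚ ℚ.* Δ) ℚ.+ s                                     ≡⟨ solve 2 (λ s D → (s :+ D) :+ s := con 2ℚ :* s :+ D) refl s (2ℚ ℚ.* Δ) ⟩
        2ℚ ℚ.* s ℚ.+ 2ℚ ℚ.* Δ                                      ∎
        where open ℚ.≤-Reasoning
      ... | no  i∉A = begin-strict
        visits t i                  ≤⟨ ℚ.≮⇒≥ (λ s<v → i∉A (∈-select⁺ high? s<v)) ⟩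
        s                           ≡⟨ sym (ℚ.+-identityʳ s) ⟩
        s ℚ.+ 0ℚ                    <⟨ ℚ.+-monoʳ-< s 0<s ⟩
        s ℚ.+ s                     ≡⟨ solve 1 (λ s → s :+ s := con 2ℚ :* s) refl s ⟩
        2ℚ ℚ.* s                    ≤⟨ ≤-from-slack (2ℚ ℚ.* Δ) (*-nonneg 0≤2 (Δ-nonneg i)) refl ⟩
        2ℚ ℚ.* s ℚ.+ 2ℚ ℚ.* Δ       ∎
        where
        open ℚ.≤-Reasoning

-- The Metropolis-Hastings walk as a symmetric chain.

module _ {n} (G : SimpleGraph n) where

  degree : Fin n → ℚ
  degree v = fromℕ (deg G v)

  degree-∑ : ∀ v → degree v ≡ ∑ (λ u → 𝟙 (adj? G v u))
  degree-∑ v = trans (∣∣-∑ (Γ G v))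
    (sum-cong-≗ (λ u → cong (λ b → if b then 1ℚ else 0ℚ) (lookup∘tabulate (λ u → does (adj? G v u)) u)))

  degree-≤-max : ∀ v → degree v ≤ fromℕ (maxDegree G)
  degree-≤-max v = fromℕ-mono-≤ (All.lookup (xs≤max 0 _) (∈-map⁺ (deg G) (∈-allFin v)))

  degree-≥1 : ∀ {u v} → Adj G u v → 1ℚ ≤ degree u
  degree-≥1 {u} {v} uv = begin
    1ℚ                      ≡⟨ sym (𝟙-yes (adj? G u v) uv) ⟩
    𝟙 (adj? G u v)          ≤⟨ term≤∑ (λ w → 𝟙-nonneg (adj? G u w)) v ⟩
    ∑ (λ w → 𝟙 (adj? G u w)) ≡⟨ sym (degree-∑ u) ⟩
    degree u                ∎
    where open ℚ.≤-Reasoning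

  -- An endpoint of an edge has positive degree, so the default value `recip zero` does not occur.
  recip-degree : ∀ {u v} → Adj G u v → recip (deg G u) ℚ.* degree u ≡ 1ℚ
  recip-degree {u} uv = recip-* (deg G u) (degree-≥1 uv)
    where
    recip-* : ∀ d → 1ℚ ≤ fromℕ d → recip d ℚ.* fromℕ d ≡ 1ℚ
    recip-* zero    1≤0 = contradiction (ℚ.<-≤-trans (ℚ.positive⁻¹ 1ℚ) 1≤0) (ℚ.<-irrefl refl)
    recip-* (suc d) _   = trans (ℚ.*-comm (recip (suc d)) (fromℕ (suc d))) (fromℕ-*-recip d)

  edgeWeight-adj : ∀ {u v} → Adj G u v → edgeWeight G u v ≡ recip (deg G u) ℚ.⊓ recip (deg G v)
  edgeWeight-adj {u} {v} uv with adj? G u v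
  ... | yes _  = refl
  ... | no ¬uv = contradiction uv ¬uv

  edgeWeight-loop : ∀ v → edgeWeight G v v ≡ 0ℚ
  edgeWeight-loop v with adj? G v v
  ... | yes vv = contradiction vv (irrefl G refl)
  ... | no _   = refl

  edgeWeight-nonneg : ∀ u v → 0ℚ ≤ edgeWeight G u v
  edgeWeight-nonneg u v with adj? G u v
  ... | yes _ = ℚ.⊓-glb (recip-nonneg (deg G u)) (recip-nonneg (deg G v))
  ... | no _  = ℚ.≤-refl

  edgeWeight-symmetric : ∀ u v → edgeWeight G u v ≡ edgeWeight G v u
  edgeWeight-symmetric u v with adj? G u v | adj? G v u
  ... | yes _  | yes _  = ℚ.⊓-comm (recip (deg G u)) (recip (deg G v))
  ... | yes uv | no ¬vu = contradiction (symm G uv) ¬vu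
  ... | no ¬uv | yes vu = contradiction (symm G vu) ¬uv
  ... | no _   | no _   = refl

  -- Each of the `deg v` edges at `v` has weight at most `1 / deg v`. This makes the weight of the
  -- self-loop nonnegative.
  ∑-edgeWeight≤1 : ∀ v → ∑ (edgeWeight G v) ≤ 1ℚ
  ∑-edgeWeight≤1 v = begin
    ∑ (edgeWeight G v)                                ≤⟨ ∑-mono pointwise ⟩
    ∑ (λ u → 𝟙 (adj? G v u) ℚ.* recip (deg G v))      ≡⟨ sym (*-distribʳ-sum (recip (deg G v)) (λ u → 𝟙 (adj? G v u))) ⟩
    ∑ (λ u → 𝟙 (adj? G v u)) ℚ.* recip (deg G v)      ≡⟨ cong (ℚ._* recip (deg G v)) (sym (degree-∑ v)) ⟩
    degree v ℚ.* recip (deg G v)                      ≤⟨ *-recip≤1 (deg G v) ⟩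
    1ℚ                                                ∎
    where
    open ℚ.≤-Reasoning
    pointwise : ∀ u → edgeWeight G v u ≤ 𝟙 (adj? G v u) ℚ.* recip (deg G v)
    pointwise u with adj? G v u
    ... | yes _ = ℚ.≤-trans (ℚ.p⊓q≤p (recip (deg G v)) (recip (deg G u))) (ℚ.≤-reflexive (sym (ℚ.*-identityˡ (recip (deg G v)))))
    ... | no _  = ℚ.≤-reflexive (sym (ℚ.*-zeroˡ (recip (deg G v))))
    *-recip≤1 : ∀ d → fromℕ d ℚ.* recip d ≤ 1ℚ
    -- At an isolated vertex the product is `0 * 0` by the default value of `recip`.
    *-recip≤1 zero    = 0≤1
    *-recip≤1 (suc d) = ℚ.≤-reflexive (fromℕ-*-recip d)

  -- Since `edgeWeight` vanishes on the diagonal, the self-loop can be written as an added point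
  -- mass, whose sum over a row is immediate.
  weight-split : ∀ v u → weight G v u ≡ edgeWeight G v u ℚ.+ 𝟙 (v ≟ᶠ u) ℚ.* (1ℚ ℚ.- ∑ (edgeWeight G v))
  weight-split v u with v ≟ᶠ u
  ... | yes refl = trans (solve 1 (λ x → x := con 0ℚ :+ con 1ℚ :* x) refl (1ℚ ℚ.- ∑ (edgeWeight G v)))
                     (cong (ℚ._+ 1ℚ ℚ.* (1ℚ ℚ.- ∑ (edgeWeight G v))) (sym (edgeWeight-loop v)))
  ... | no _     = solve 2 (λ x y → x := x :+ con 0ℚ :* y) refl (edgeWeight G v u) (1ℚ ℚ.- ∑ (edgeWeight G v))

  weight-isSymmetricChain : IsSymmetricChain (weight G)
  weight-isSymmetricChain = record { nonneg = nonneg ; symmetric = symmetric ; row-sum = row-sum }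
    where
    nonneg : ∀ u v → 0ℚ ≤ weight G u v
    nonneg u v with u ≟ᶠ v
    ... | yes _ = slack (∑-edgeWeight≤1 u)
    ... | no _  = edgeWeight-nonneg u v
    symmetric : ∀ u v → weight G u v ≡ weight G v u
    symmetric u v with u ≟ᶠ v | v ≟ᶠ u
    ... | yes refl | yes _   = refl
    ... | yes refl | no u≢u  = contradiction refl u≢u
    ... | no u≢u   | yes refl = contradiction refl u≢u
    ... | no _     | no _    = edgeWeight-symmetric u v
    row-sum : ∀ u → ∑ (weight G u) ≡ 1ℚ
    row-sum u = begin
      ∑ (weight G u)
        ≡⟨ sum-cong-≗ (weight-split u) ⟩
      ∑ (λ v → edgeWeight G u v ℚ.+ 𝟙 (u ≟ᶠ v) ℚ.* (1ℚ ℚ.- ∑ (edgeWeight G u)))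
        ≡⟨ ∑-distrib-+ (edgeWeight G u) (λ v → 𝟙 (u ≟ᶠ v) ℚ.* (1ℚ ℚ.- ∑ (edgeWeight G u))) ⟩
      ∑ (edgeWeight G u) ℚ.+ ∑ (λ v → 𝟙 (u ≟ᶠ v) ℚ.* (1ℚ ℚ.- ∑ (edgeWeight G u)))
        ≡⟨ cong (∑ (edgeWeight G u) ℚ.+_) (∑-δ u (λ _ → 1ℚ ℚ.- ∑ (edgeWeight G u))) ⟩
      ∑ (edgeWeight G u) ℚ.+ (1ℚ ℚ.- ∑ (edgeWeight G u))
        ≡⟨ solve 1 (λ x → x :+ (con 1ℚ :- x) := con 1ℚ) refl (∑ (edgeWeight G u)) ⟩
      1ℚ ∎
      where open ≡-Reasoning

  weight-adj : ∀ {u v} → Adj G u v → weight G u v ≡ recip (deg G u) ℚ.⊓ recip (deg G v)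
  weight-adj {u} {v} uv with u ≟ᶠ v
  ... | yes refl = contradiction uv (irrefl G refl)
  ... | no _     = edgeWeight-adj uv

  edge-resistance : ∀ {u v} → Adj G u v →
    ∃[ d ] weight G u v ℚ.* d ≡ 1ℚ × d ≤ degree u ℚ.+ degree v × d ≤ fromℕ (maxDegree G)
  edge-resistance {u} {v} uv = ⊓-inverse {p = recip (deg G u)} {recip (deg G v)} {degree u} {degree v} (weight-adj uv) (recip-degree uv) (recip-degree (symm G uv))
    (fromℕ-nonneg (deg G u)) (fromℕ-nonneg (deg G v)) (degree-≤-max u) (degree-≤-max v)

-- Rational approximation of √t from below.

√-floor : ∀ m → ∃[ k ] k * k ℕ.≤ m × m < suc k * suc k
√-floor zero    = 0 , ℕ.z≤n , ℕ.s≤s ℕ.z≤n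
√-floor (suc m) with √-floor m
... | k , k²≤m , m<k′² with suc m ℕ.<? suc k * suc k
...   | yes m′<k′² = k , ℕ.m≤n⇒m≤1+n k²≤m , m′<k′²
...   | no  m′≮k′² = suc k , ℕ.≮⇒≥ m′≮k′² , (ℕ.<-≤-trans (ℕ.s≤s m<k′²)
        (ℕ.≤-trans (ℕ.s≤s (ℕ.m≤n+m (suc k * suc k) (suc k)))
                   (ℕ.+-monoʳ-≤ (2 + k) (ℕ.*-monoʳ-≤ (suc k) (ℕ.n≤1+n (suc k))))))

-- The witness is ⌊d √t⌋ / d for d = 2 m + 1: if d ≤ k and N ≤ k² + 2 k, then
-- m N ≤ m k² + 2 m k < (m + 1) k².
√-approximation : ∀ m {t} → 0 < t →
  ∃[ x ] 0ℚ ℚ.< x × x ℚ.* x ≤ fromℕ t × fromℕ m ℚ.* fromℕ t ℚ.< fromℕ (suc m) ℚ.* (x ℚ.* x)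
√-approximation m {t} 0<t with √-floor (suc (2 * m) * suc (2 * m) * t)
... | k , k²≤N , N<k′² = x , 0<x , x²≤t , mt<x²
  where
  d = suc (2 * m)
  c = recip d
  x = fromℕ k ℚ.* c
  d≤k : d ℕ.≤ k
  -- As `t ≥ 1`, the inequality `k < d` would give `(k + 1)² ≤ d² ≤ d² t < (k + 1)²`.
  d≤k = ℕ.≮⇒≥ (λ k<d → ℕ.<-irrefl refl (ℕ.<-≤-trans N<k′² (ℕ.≤-trans (ℕ.*-mono-≤ k<d k<d)
    (ℕ.m≤m*n (d * d) t {{ℕ.>-nonZero 0<t}}))))
  0<k : 0 < k
  0<k = ℕ.≤-trans (ℕ.s≤s ℕ.z≤n) d≤k
  mN<k² : m * (d * d * t) < suc m * (k * k)
  mN<k² = begin-strict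
    m * (d * d * t)              ≤⟨ ℕ.*-monoʳ-≤ m (ℕ.s≤s⁻¹ N<k′²) ⟩
    m * (k + k * suc k)          ≡⟨ ℕ-solve 2 (λ m k → m :*′ (k :+′ k :*′ (con′ 1 :+′ k)) :=′ con′ 2 :*′ m :*′ k :+′ m :*′ (k :*′ k)) refl m k ⟩
    2 * m * k + m * (k * k)      <⟨ ℕ.+-monoˡ-< (m * (k * k)) (ℕ.*-monoˡ-< k {{ℕ.>-nonZero 0<k}} d≤k) ⟩
    suc m * (k * k)              ∎
    where open ℕ.≤-Reasoning
  dc≡1 : fromℕ d ℚ.* c ≡ 1ℚ
  dc≡1 = fromℕ-*-recip (2 * m)
  0<c : 0ℚ ℚ.< c
  0<c = ℚ.*-cancelˡ-<-nonNeg (fromℕ d) {{ℚ.nonNegative (fromℕ-nonneg d)}}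
    (subst₂ ℚ._<_ (sym (ℚ.*-zeroʳ (fromℕ d))) (sym dc≡1) (ℚ.positive⁻¹ 1ℚ))
  0<c² : 0ℚ ℚ.< c ℚ.* c
  0<c² = subst (ℚ._< c ℚ.* c) (ℚ.*-zeroʳ c) (ℚ.*-monoʳ-<-pos c {{ℚ.positive 0<c}} 0<c)
  0<x : 0ℚ ℚ.< x
  0<x = subst (ℚ._< x) (ℚ.*-zeroˡ c) (ℚ.*-monoˡ-<-pos c {{ℚ.positive 0<c}} (fromℕ-mono-< 0<k))
  k²c² : fromℕ (k * k) ℚ.* (c ℚ.* c) ≡ x ℚ.* x
  k²c² = trans (cong (ℚ._* (c ℚ.* c)) (fromℕ-* k k))
    (solve 2 (λ k c → (k :* k) :* (c :* c) := (k :* c) :* (k :* c)) refl (fromℕ k) c)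
  Nc² : fromℕ (d * d * t) ℚ.* (c ℚ.* c) ≡ fromℕ t
  Nc² = begin
    fromℕ (d * d * t) ℚ.* (c ℚ.* c)                      ≡⟨ cong (ℚ._* (c ℚ.* c)) (trans (fromℕ-* (d * d) t) (cong (ℚ._* fromℕ t) (fromℕ-* d d))) ⟩
    fromℕ d ℚ.* fromℕ d ℚ.* fromℕ t ℚ.* (c ℚ.* c)        ≡⟨ solve 3 (λ d c t → d :* d :* t :* (c :* c) := (d :* c) :* (d :* c) :* t) refl (fromℕ d) c (fromℕ t) ⟩
    (fromℕ d ℚ.* c) ℚ.* (fromℕ d ℚ.* c) ℚ.* fromℕ t      ≡⟨ cong (λ e → e ℚ.* e ℚ.* fromℕ t) dc≡1 ⟩
    1ℚ ℚ.* fromℕ t                                       ≡⟨ ℚ.*-identityˡ (fromℕ t) ⟩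
    fromℕ t                                              ∎
    where open ≡-Reasoning
  scale : ∀ m n → fromℕ (m * n) ℚ.* (c ℚ.* c) ≡ fromℕ m ℚ.* (fromℕ n ℚ.* (c ℚ.* c))
  scale m n = trans (cong (ℚ._* (c ℚ.* c)) (fromℕ-* m n)) (ℚ.*-assoc (fromℕ m) (fromℕ n) (c ℚ.* c))
  x²≤t : x ℚ.* x ≤ fromℕ t
  x²≤t = subst₂ _≤_ k²c² Nc² (*-monoʳ (ℚ.<⇒≤ 0<c²) (fromℕ-mono-≤ k²≤N))
  mt<x² : fromℕ m ℚ.* fromℕ t ℚ.< fromℕ (suc m) ℚ.* (x ℚ.* x)
  mt<x² = subst₂ ℚ._<_
    (trans (scale m (d * d * t)) (cong (fromℕ m ℚ.*_) Nc²))
    (trans (scale (suc m) (k * k)) (cong (fromℕ (suc m) ℚ.*_) k²c²))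
    (ℚ.*-monoˡ-<-pos (c ℚ.* c) {{ℚ.positive 0<c²}} (fromℕ-mono-< mN<k²))

-- The threshold is `s = 5 x / 2`, so that `2 s = 5 x`. Dividing `24 t < 25 x²` by 4 gives
-- `6 t < s²`; because `6 < 25 / 4`, there is room for a rational `x` slightly below √t.
<5√+-from-half : ∀ {t p q} → ∃[ x ] 0ℚ ℚ.< x × x ℚ.* x ≤ t × fromℕ 24 ℚ.* t ℚ.< fromℕ 25 ℚ.* (x ℚ.* x) →
  (∀ s → 0ℚ ℚ.< s → fromℕ 6 ℚ.* t ℚ.< s ℚ.* s → p ℚ.< 2ℚ ℚ.* s ℚ.+ q) →
  ∃[ x ] 0ℚ ≤ x × x ℚ.* x ≤ t × p ℚ.< fromℕ 5 ℚ.* x ℚ.+ q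
<5√+-from-half {t} {p} {q} (x , 0<x , x²≤t , 24t<25x²) bound = x , ℚ.<⇒≤ 0<x , x²≤t
  , subst (λ e → p ℚ.< e ℚ.+ q) (solve 1 (λ x → con 2ℚ :* (con c :* x) := con (fromℕ 5) :* x) refl x)
      (bound (c ℚ.* x) 0<s 6t<s²)
  where
  c = fromℕ 5 ℚ.* recip 2
  0<s : 0ℚ ℚ.< c ℚ.* x
  0<s = subst (ℚ._< c ℚ.* x) (ℚ.*-zeroʳ c) (ℚ.*-monoʳ-<-pos c 0<x)
  6t<s² : fromℕ 6 ℚ.* t ℚ.< (c ℚ.* x) ℚ.* (c ℚ.* x)
  6t<s² = subst₂ ℚ._<_
    (solve 1 (λ t → con (recip 4) :* (con (fromℕ 24) :* t) := con (fromℕ 6) :* t) refl t)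
    (solve 1 (λ x → con (recip 4) :* (con (fromℕ 25) :* (x :* x)) := (con c :* x) :* (con c :* x)) refl x)
    (ℚ.*-monoʳ-<-pos (recip 4) 24t<25x²)

<5√+-intro : ∀ {t p q} → 0 < t →
  (∀ s → 0ℚ ℚ.< s → fromℕ 6 ℚ.* fromℕ t ℚ.< s ℚ.* s → p ℚ.< 2ℚ ℚ.* s ℚ.+ q) → p < fromℕ 5 √ t + q
<5√+-intro {t} {p} {q} 0<t bound = <5√+-from-half {fromℕ t} {p} {q} (√-approximation 24 {t} 0<t) bound

-- Assembly of both bounds with natural-number constants.

fromℕ-<-6n² : ∀ {t n} → t < 6 * n ^ 2 → fromℕ t ℚ.< fromℕ 6 ℚ.* (fromℕ n ℚ.* fromℕ n)
fromℕ-<-6n² {t} {n} t<6n² = subst (fromℕ t ℚ.<_)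
  (trans (fromℕ-* 6 (n ^ 2)) (cong (fromℕ 6 ℚ.*_) (trans (cong fromℕ (cong (n *_) (ℕ.*-identityʳ n))) (fromℕ-* n n))))
  (fromℕ-mono-< t<6n²)

lemma2 : ∀ (n : ℕ) (G : SimpleGraph n) → Connected G →
    ∀ (A : Subset n) → A ⊂ ⊤ → ∀ (i : Fin n) → i ∈ A →
    ExpectationBelow (ℙ[T≡] G i (∁ A)) (fromℕ ((∣ A ∣ + 1) * (6 * ∣ A ∣ + 2 * maxDegree G)))
    × (∀ (t : ℕ) → 0 < t → t < 6 * n ^ 2 →
       𝔼N G t i < fromℕ 5 √ t + fromℕ (2 * maxDegree G))
lemma2 n G connected A (_ , x , _ , x∉A) i i∈A = hitting , visiting
  where
  chain = weight-isSymmetricChain G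
  a = ∣ A ∣
  Δ = maxDegree G
  R = 6 * a + 2 * Δ
  module Bounds = Resistance.Bounds G chain (degree G) (degree-∑ G) (fromℕ Δ) (degree-≤-max G) (edge-resistance G) connected

  aR : fromℕ a ℚ.* (fromℕ 6 ℚ.* fromℕ a ℚ.+ 2ℚ ℚ.* fromℕ Δ) ≡ fromℕ (a * R)
  aR = sym (trans (fromℕ-* a R) (cong (fromℕ a ℚ.*_)
    (trans (fromℕ-+ (6 * a) (2 * Δ)) (cong₂ ℚ._+_ (fromℕ-* 6 a) (fromℕ-* 2 Δ)))))

  -- The exit times are bounded by `a * R`; one more `R`, positive because `A` contains `i`, makes
  -- the bound strict.
  aR< : a * R < (a + 1) * R
  aR< = ℕ.*-monoˡ-< R {{ℕ.>-nonZero 0<R}} (subst (a <_) (ℕ.+-comm 1 a) (ℕ.n<1+n a))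
    where
    0<R : 0 < R
    0<R = ℕ.≤-trans (x∈p⇒1≤∣p∣ i∈A) (ℕ.≤-trans (ℕ.m≤n*m a 6) (ℕ.m≤m+n (6 * a) (2 * Δ)))

  hitting : ExpectationBelow (ℙ[T≡] G i (∁ A)) (fromℕ ((a + 1) * R))
  hitting = Expectations.Hitting.exit-expectationBelow chain A i∈A {a * R} {(a + 1) * R} aR<
    (λ m → subst (Expectations.Hitting.truncatedTime chain A m i ≤_) aR (Bounds.truncatedTime-≤ x∉A i∈A m))

  visiting : ∀ t → 0 < t → t < 6 * n ^ 2 → 𝔼N G t i < fromℕ 5 √ t + fromℕ (2 * Δ)
  visiting t 0<t t<6n² = <5√+-intro {t} {𝔼N G t i} {fromℕ (2 * Δ)} 0<t (λ s 0<s 6t<s² →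
    subst₂ (λ y D → y ℚ.< 2ℚ ℚ.* s ℚ.+ D) (sym (Expectations.Visits.𝔼-N chain i t i)) (sym (fromℕ-* 2 Δ))
      (Bounds.visits-< {i} {t} {s} 0<s 6t<s² (fromℕ-<-6n² {t} {n} t<6n²)))
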